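{- Let $K$ be a quadratic field with embeddings into $\mathbb{R}$ and $\mathbb{Q}_2$, let $\alpha\in K$, and let $\{p_n/q_n\}$ be the convergents of $\alpha$ obtained from the algorithm described in the context. Then, in $\mathbb{R}$, $$\alpha_\infty=\lim_{n\to\infty}\frac{p_n}{q_n}.$$
   Context: $K$ is a quadratic field with fixed field embeddings $\sigma_\infty:K\to\mathbb{R}$ and $\sigma_2:K\to\mathbb{Q}_2$. For $\alpha\in K$ write $\alpha_\infty=\sigma_\infty(\alpha)$, $\alpha_{\langle 2\rangle}=\sigma_2(\alpha)$. For $u=\sum_{n}c_n2^n\in\mathbb{Q}_2$ with digits $c_n\in\{0,1\}$ ($c_n=0$ for $n<v_2(u)$), put $\lfloor u\rfloor_2=\sum_{n\le 0}c_n2^n\in\mathbb{Z}[1/2]$. For $\alpha\in K$ let $b^{(0)}(\alpha)=2m+\lfloor\alpha_{\langle 2\rangle}\rfloor_2$, where $m$ is the smallest among the integers $i$ minimizing $|\alpha_\infty-2i-\lfloor\alpha_{\langle 2\rangle}\rfloor_2|$; let $b^{(1)}(\alpha)=m'+\lfloor\alpha_{\langle 2\rangle}\rfloor_2$, where $m'$ is the smallest among the integers $i$ minimizing $|\alpha_\infty-i-\lfloor\alpha_{\langle 2\rangle}\rfloor_2|$. For $\epsilon\in\{0,1\}$ let $F_{2,\epsilon}(\alpha)=\frac{1}{\alpha-b^{(\epsilon)}(\alpha)}$, undefined if $\alpha=b^{(\epsilon)}(\alpha)$. Algorithm: $\alpha_0=\alpha$; for $n\ge0$ put $\epsilon=0$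 if $n$ is even and $\epsilon=1$ if $n$ is odd, $b_n(\alpha)=b^{(\epsilon)}(\alpha_n)$ and $\alpha_{n+1}=F_{2,\epsilon}(\alpha_n)$; the algorithm halts if $F_{2,\epsilon}(\alpha_n)$ is undefined. Convergents: $p_{ -1}=1$, $q_{ -1}=0$ and, for $n\ge0$ (as long as $b_n(\alpha)$ is defined), $$\begin{pmatrix} p_n & p_{n-1} \\ q_n & q_{n-1} \end{pmatrix}=\begin{pmatrix} b_0(\alpha) & 1 \\ 1 & 0 \end{pmatrix}\cdots\begin{pmatrix} b_n(\alpha) & 1 \\ 1 & 0 \end{pmatrix}.$$ One has $q_n\neq0$ for all such $n\ge0$. If the algorithm halts (as happens for $\alpha\in\mathbb{Q}$), so that there are only finitely many convergents $p_0/q_0,\dots,p_N/q_N$, the limit is understood as the last convergent $p_N/q_N$. -}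

module Defs where

open import Level using (0ℓ)
open import Algebra.Bundles using (CommutativeRing; RawRing)
open import Algebra.Morphism.Structures using (module RingMorphisms)
open import Data.Nat.Base as ℕ using (ℕ; zero; suc; parity)
import Data.Nat.Properties as ℕ
import Data.Nat.DivMod as ℕ
open import Data.Integer.Base as ℤ using (ℤ; +_; _%ℕ_)
import Data.Integer.Properties as ℤ
open import Data.Integer.Divisibility.Signed as ℤ using (∣m∣n⇒∣m+n; ∣m⇒∣-m; ∣n⇒∣m*n; ∣m⇒∣m*n)
open import Data.Integer.Solver as ℤSolver using ()
open import Data.Parity.Base using (Parity; 0ℙ; 1ℙ)
open import Data.Rational.Base as ℚ using (ℚ; 0ℚ; 1ℚ; ½)
import Data.Rational.Properties as ℚ
open import Data.Rational.Solver as ℚSolver using ()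
open import Data.Product.Base using (∃; ∃-syntax; ∃₂; _×_; _,_; proj₁; proj₂)
open import Data.Sum.Base using (inj₁; inj₂)
open import Relation.Nullary using (¬_)
open import Relation.Binary.PropositionalEquality using (_≡_; _≢_; refl; sym; trans; cong; cong₂; subst)

-- ℝ consists of Cauchy sequences of rationals, with equality _≈ᴿ_ below.

IsCauchy : (ℕ → ℚ) → Set
IsCauchy x = ∀ ε → 0ℚ ℚ.< ε →
  ∃[ N ] (∀ m n → N ℕ.≤ m → N ℕ.≤ n → ℚ.∣ x m ℚ.- x n ∣ ℚ.< ε)

record ℝ : Set where
  constructor mkℝ
  field
    seq    : ℕ → ℚ
    cauchy : IsCauchy seq

open ℝ public

private
  half+half : ∀ ε → ½ ℚ.* ε ℚ.+ ½ ℚ.* ε ≡ ε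
  half+half ε = trans (sym (ℚ.*-distribʳ-+ ε ½ ½)) (ℚ.*-identityˡ ε)

  *-pos : ∀ {p q} → 0ℚ ℚ.< p → 0ℚ ℚ.< q → 0ℚ ℚ.< p ℚ.* q
  *-pos {p} {q} p>0 q>0 =
    ℚ.positive⁻¹ (p ℚ.* q) {{ℚ.pos*pos⇒pos p {{ℚ.positive p>0}} q {{ℚ.positive q>0}}}}

  half-pos : ∀ {ε} → 0ℚ ℚ.< ε → 0ℚ ℚ.< ½ ℚ.* ε
  half-pos = *-pos (ℚ.positive⁻¹ ½)

  ∣a∣≤∣a-b∣+∣b∣ : ∀ a b → ℚ.∣ a ∣ ℚ.≤ ℚ.∣ a ℚ.- b ∣ ℚ.+ ℚ.∣ b ∣
  ∣a∣≤∣a-b∣+∣b∣ a b = subst (λ t → ℚ.∣ t ∣ ℚ.≤ ℚ.∣ a ℚ.- b ∣ ℚ.+ ℚ.∣ b ∣)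
    (solve 2 (λ a b → (a :- b) :+ b := a) refl a b) (ℚ.∣p+q∣≤∣p∣+∣q∣ (a ℚ.- b) b)
    where open ℚSolver.+-*-Solver

  ∣a-b∣≡∣b-a∣ : ∀ a b → ℚ.∣ a ℚ.- b ∣ ≡ ℚ.∣ b ℚ.- a ∣
  ∣a-b∣≡∣b-a∣ a b = trans (sym (ℚ.∣-p∣≡∣p∣ (a ℚ.- b)))
    (cong ℚ.∣_∣ (solve 2 (λ a b → :- (a :- b) := b :- a) refl a b))
    where open ℚSolver.+-*-Solver

  ∣a∣-∣b∣≤∣a-b∣ : ∀ a b → ℚ.∣ a ∣ ℚ.- ℚ.∣ b ∣ ℚ.≤ ℚ.∣ a ℚ.- b ∣
  ∣a∣-∣b∣≤∣a-b∣ a b = subst (ℚ.∣ a ∣ ℚ.- ℚ.∣ b ∣ ℚ.≤_)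
    (solve 2 (λ d c → (d :+ c) :- c := d) refl ℚ.∣ a ℚ.- b ∣ ℚ.∣ b ∣)
    (ℚ.+-monoˡ-≤ (ℚ.- ℚ.∣ b ∣) (∣a∣≤∣a-b∣+∣b∣ a b))
    where open ℚSolver.+-*-Solver

  ∣∣a∣-∣b∣∣≤∣a-b∣ : ∀ a b → ℚ.∣ ℚ.∣ a ∣ ℚ.- ℚ.∣ b ∣ ∣ ℚ.≤ ℚ.∣ a ℚ.- b ∣
  ∣∣a∣-∣b∣∣≤∣a-b∣ a b with ℚ.∣p∣≡p∨∣p∣≡-p (ℚ.∣ a ∣ ℚ.- ℚ.∣ b ∣)
  ... | inj₁ e = subst (ℚ._≤ ℚ.∣ a ℚ.- b ∣) (sym e) (∣a∣-∣b∣≤∣a-b∣ a b)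
  ... | inj₂ e = subst (ℚ._≤ ℚ.∣ a ℚ.- b ∣) (sym e′)
                   (subst (ℚ.∣ b ∣ ℚ.- ℚ.∣ a ∣ ℚ.≤_) (∣a-b∣≡∣b-a∣ b a) (∣a∣-∣b∣≤∣a-b∣ b a))
    where
    open ℚSolver.+-*-Solver
    e′ : ℚ.∣ ℚ.∣ a ∣ ℚ.- ℚ.∣ b ∣ ∣ ≡ ℚ.∣ b ∣ ℚ.- ℚ.∣ a ∣
    e′ = trans e (solve 2 (λ a b → :- (a :- b) := b :- a) refl ℚ.∣ a ∣ ℚ.∣ b ∣)

  const-cauchy : ∀ q → IsCauchy (λ _ → q)
  const-cauchy q ε ε>0 = 0 , λ _ _ _ _ →
    subst (λ t → ℚ.∣ t ∣ ℚ.< ε) (sym (ℚ.+-inverseʳ q)) ε>0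

  +-cauchy : ∀ {x y} → IsCauchy x → IsCauchy y → IsCauchy (λ n → x n ℚ.+ y n)
  +-cauchy {x} {y} cx cy ε ε>0
    with cx (½ ℚ.* ε) (half-pos ε>0) | cy (½ ℚ.* ε) (half-pos ε>0)
  ... | M , hM | N , hN = M ℕ.⊔ N , λ m n m≥ n≥ → begin-strict
    ℚ.∣ (x m ℚ.+ y m) ℚ.- (x n ℚ.+ y n) ∣
      ≡⟨ cong ℚ.∣_∣ (solve 4 (λ a b c d → (a :+ b) :- (c :+ d) := (a :- c) :+ (b :- d)) refl (x m) (y m) (x n) (y n)) ⟩
    ℚ.∣ (x m ℚ.- x n) ℚ.+ (y m ℚ.- y n) ∣
      ≤⟨ ℚ.∣p+q∣≤∣p∣+∣q∣ (x m ℚ.- x n) (y m ℚ.- y n) ⟩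
    ℚ.∣ x m ℚ.- x n ∣ ℚ.+ ℚ.∣ y m ℚ.- y n ∣
      <⟨ ℚ.+-mono-< (hM m n (ℕ.m⊔n≤o⇒m≤o M N m≥) (ℕ.m⊔n≤o⇒m≤o M N n≥))
                    (hN m n (ℕ.m⊔n≤o⇒n≤o M N m≥) (ℕ.m⊔n≤o⇒n≤o M N n≥)) ⟩
    ½ ℚ.* ε ℚ.+ ½ ℚ.* ε
      ≡⟨ half+half ε ⟩
    ε ∎
    where
    open ℚ.≤-Reasoning
    open ℚSolver.+-*-Solver

  neg-cauchy : ∀ {x} → IsCauchy x → IsCauchy (λ n → ℚ.- x n)
  neg-cauchy {x} cx ε ε>0 with cx ε ε>0
  ... | N , h = N , λ m n m≥ n≥ → subst (ℚ._< ε)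
    (trans (sym (ℚ.∣-p∣≡∣p∣ (x m ℚ.- x n))) (cong ℚ.∣_∣ (ℚ.neg-distrib-+ (x m) (ℚ.- x n))))
    (h m n m≥ n≥)

  abs-cauchy : ∀ {x} → IsCauchy x → IsCauchy (λ n → ℚ.∣ x n ∣)
  abs-cauchy {x} cx ε ε>0 with cx ε ε>0
  ... | N , h = N , λ m n m≥ n≥ → ℚ.≤-<-trans (∣∣a∣-∣b∣∣≤∣a-b∣ (x m) (x n)) (h m n m≥ n≥)

  bounded : ∀ {x} → IsCauchy x →
    ∃₂ λ B N → 0ℚ ℚ.< B × (∀ n → N ℕ.≤ n → ℚ.∣ x n ∣ ℚ.≤ B)
  bounded {x} cx with cx 1ℚ (ℚ.positive⁻¹ 1ℚ)
  ... | N , h = 1ℚ ℚ.+ ℚ.∣ x N ∣ , N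
    , ℚ.+-mono-<-≤ (ℚ.positive⁻¹ 1ℚ) (ℚ.0≤∣p∣ (x N))
    , λ n n≥ → ℚ.≤-trans (∣a∣≤∣a-b∣+∣b∣ (x n) (x N))
                 (ℚ.+-monoˡ-≤ ℚ.∣ x N ∣ (ℚ.<⇒≤ (h n N n≥ ℕ.≤-refl)))

  scaled : ∀ {B} → 0ℚ ℚ.< B → ∀ {ε} → 0ℚ ℚ.< ε → ∃[ δ ] (0ℚ ℚ.< δ × B ℚ.* δ ≡ ½ ℚ.* ε)
  scaled {B} B>0 {ε} ε>0 = ℚ.1/ B ℚ.* (½ ℚ.* ε)
    , *-pos (ℚ.positive⁻¹ (ℚ.1/ B) {{ℚ.1/pos⇒pos B}}) (half-pos ε>0)
    , trans (sym (ℚ.*-assoc B (ℚ.1/ B) (½ ℚ.* ε)))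
        (trans (cong (ℚ._* (½ ℚ.* ε)) (ℚ.*-inverseʳ B)) (ℚ.*-identityˡ (½ ℚ.* ε)))
    where
    instance
      B-pos : ℚ.Positive B
      B-pos = ℚ.positive B>0
      B≢0 : ℚ.NonZero B
      B≢0 = ℚ.pos⇒nonZero B

  product-bound : ∀ {B δ} a d → 0ℚ ℚ.< B → ℚ.∣ a ∣ ℚ.≤ B → ℚ.∣ d ∣ ℚ.< δ →
    ℚ.∣ a ℚ.* d ∣ ℚ.< B ℚ.* δ
  product-bound {B} {δ} a d B>0 a≤B d<δ = begin-strict
    ℚ.∣ a ℚ.* d ∣        ≡⟨ ℚ.∣p*q∣≡∣p∣*∣q∣ a d ⟩
    ℚ.∣ a ∣ ℚ.* ℚ.∣ d ∣  ≤⟨ ℚ.*-monoʳ-≤-nonNeg ℚ.∣ d ∣ {{ℚ.∣-∣-nonNeg d}} a≤B ⟩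
    B ℚ.* ℚ.∣ d ∣        <⟨ ℚ.*-monoʳ-<-pos B {{ℚ.positive B>0}} d<δ ⟩
    B ℚ.* δ ∎
    where open ℚ.≤-Reasoning

  product-difference : ∀ a b c d →
    a ℚ.* b ℚ.- c ℚ.* d ≡ a ℚ.* (b ℚ.- d) ℚ.+ d ℚ.* (a ℚ.- c)
  product-difference = solve 4
    (λ a b c d → a :* b :- c :* d := a :* (b :- d) :+ d :* (a :- c)) refl
    where open ℚSolver.+-*-Solver

  products-close : ∀ {A B δ η} ε a b c d → 0ℚ ℚ.< A → 0ℚ ℚ.< B →
    A ℚ.* δ ≡ ½ ℚ.* ε → B ℚ.* η ≡ ½ ℚ.* ε →
    ℚ.∣ a ∣ ℚ.≤ A → ℚ.∣ d ∣ ℚ.≤ B → ℚ.∣ b ℚ.- d ∣ ℚ.< δ → ℚ.∣ a ℚ.- c ∣ ℚ.< η →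
    ℚ.∣ a ℚ.* b ℚ.- c ℚ.* d ∣ ℚ.< ε
  products-close {A} {B} {δ} {η} ε a b c d A>0 B>0 Aδ Bη a≤A d≤B b-d<δ a-c<η = begin-strict
    ℚ.∣ a ℚ.* b ℚ.- c ℚ.* d ∣
      ≡⟨ cong ℚ.∣_∣ (product-difference a b c d) ⟩
    ℚ.∣ a ℚ.* (b ℚ.- d) ℚ.+ d ℚ.* (a ℚ.- c) ∣
      ≤⟨ ℚ.∣p+q∣≤∣p∣+∣q∣ (a ℚ.* (b ℚ.- d)) (d ℚ.* (a ℚ.- c)) ⟩
    ℚ.∣ a ℚ.* (b ℚ.- d) ∣ ℚ.+ ℚ.∣ d ℚ.* (a ℚ.- c) ∣
      <⟨ ℚ.+-mono-< (product-bound a (b ℚ.- d) A>0 a≤A b-d<δ)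
                    (product-bound d (a ℚ.- c) B>0 d≤B a-c<η) ⟩
    A ℚ.* δ ℚ.+ B ℚ.* η
      ≡⟨ cong₂ ℚ._+_ Aδ Bη ⟩
    ½ ℚ.* ε ℚ.+ ½ ℚ.* ε
      ≡⟨ half+half ε ⟩
    ε ∎
    where open ℚ.≤-Reasoning

  *-cauchy : ∀ {x y} → IsCauchy x → IsCauchy y → IsCauchy (λ n → x n ℚ.* y n)
  *-cauchy {x} {y} cx cy ε ε>0 =
    let
      A , K , A>0 , hA = bounded {x} cx
      B , L , B>0 , hB = bounded {y} cy
      δ , δ>0 , Aδ     = scaled A>0 ε>0
      η , η>0 , Bη     = scaled B>0 ε>0
      M , hM           = cy δ δ>0
      N , hN           = cx η η>0
    in (K ℕ.⊔ L) ℕ.⊔ (M ℕ.⊔ N) , λ m n m≥ n≥ →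
    let
      KL≤m = ℕ.m⊔n≤o⇒m≤o (K ℕ.⊔ L) (M ℕ.⊔ N) m≥
      KL≤n = ℕ.m⊔n≤o⇒m≤o (K ℕ.⊔ L) (M ℕ.⊔ N) n≥
      MN≤m = ℕ.m⊔n≤o⇒n≤o (K ℕ.⊔ L) (M ℕ.⊔ N) m≥
      MN≤n = ℕ.m⊔n≤o⇒n≤o (K ℕ.⊔ L) (M ℕ.⊔ N) n≥
    in products-close ε (x m) (y m) (x n) (y n) A>0 B>0 Aδ Bη
         (hA m (ℕ.m⊔n≤o⇒m≤o K L KL≤m))
         (hB n (ℕ.m⊔n≤o⇒n≤o K L KL≤n))
         (hM m n (ℕ.m⊔n≤o⇒m≤o M N MN≤m) (ℕ.m⊔n≤o⇒m≤o M N MN≤n))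
         (hN m n (ℕ.m⊔n≤o⇒n≤o M N MN≤m) (ℕ.m⊔n≤o⇒n≤o M N MN≤n))

infix  4 _≈ᴿ_ _≤ᴿ_ _<ᴿ_
infixl 6 _+ᴿ_ _-ᴿ_
infixl 7 _*ᴿ_

_≈ᴿ_ _≤ᴿ_ _<ᴿ_ : ℝ → ℝ → Set
x ≈ᴿ y = ∀ ε → 0ℚ ℚ.< ε → ∃[ N ] (∀ n → N ℕ.≤ n → ℚ.∣ seq x n ℚ.- seq y n ∣ ℚ.< ε)
x ≤ᴿ y = ∀ ε → 0ℚ ℚ.< ε → ∃[ N ] (∀ n → N ℕ.≤ n → seq x n ℚ.< seq y n ℚ.+ ε)
x <ᴿ y = ∃[ ε ] (0ℚ ℚ.< ε × ∃[ N ] (∀ n → N ℕ.≤ n → seq x n ℚ.+ ε ℚ.< seq y n))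

fromℚ : ℚ → ℝ
fromℚ q = mkℝ (λ _ → q) (const-cauchy q)

_+ᴿ_ _*ᴿ_ _-ᴿ_ : ℝ → ℝ → ℝ
mkℝ x cx +ᴿ mkℝ y cy = mkℝ (λ n → x n ℚ.+ y n) (+-cauchy {x} {y} cx cy)
mkℝ x cx *ᴿ mkℝ y cy = mkℝ (λ n → x n ℚ.* y n) (*-cauchy {x} {y} cx cy)

negᴿ absᴿ : ℝ → ℝ
negᴿ (mkℝ x cx) = mkℝ (λ n → ℚ.- x n) (neg-cauchy {x} cx)
absᴿ (mkℝ x cx) = mkℝ (λ n → ℚ.∣ x n ∣) (abs-cauchy {x} cx)

x -ᴿ y = x +ᴿ negᴿ y

ℝ-rawRing : RawRing 0ℓ 0ℓ
ℝ-rawRing = record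
  { Carrier = ℝ ; _≈_ = _≈ᴿ_ ; _+_ = _+ᴿ_ ; _*_ = _*ᴿ_ ; -_ = negᴿ
  ; 0# = fromℚ 0ℚ ; 1# = fromℚ 1ℚ }

infix 4 _⟶_

_⟶_ : (ℕ → ℝ) → ℝ → Set
s ⟶ x = ∀ ε → fromℚ 0ℚ <ᴿ ε → ∃[ N ] (∀ n → N ℕ.≤ n → absᴿ (s n -ᴿ x) <ᴿ ε)

-- The 2-adic integers as the inverse limit of the ℤ/2ⁿ (residue n
-- represents the class modulo 2ⁿ), and ℚ₂ = ℤ₂[1/2].

infix 4 _≡_[2^_]

_≡_[2^_] : ℤ → ℤ → ℕ → Set
i ≡ j [2^ n ] = (+ (2 ℕ.^ n)) ℤ.∣ (i ℤ.- j)

record ℤ₂ : Set where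
  constructor mkℤ₂
  field
    residue  : ℕ → ℤ
    coherent : ∀ n → residue (suc n) ≡ residue n [2^ n ]

open ℤ₂ public

private
  ≡2^-reflexive : ∀ i n → i ≡ i [2^ n ]
  ≡2^-reflexive i n = subst ((+ (2 ℕ.^ n)) ℤ.∣_) (sym (ℤ.+-inverseʳ i)) (ℤ.divides ℤ.0ℤ refl)

  +-cong2^ : ∀ {i j k l n} → i ≡ j [2^ n ] → k ≡ l [2^ n ] → i ℤ.+ k ≡ j ℤ.+ l [2^ n ]
  +-cong2^ {i} {j} {k} {l} {n} p q = subst ((+ (2 ℕ.^ n)) ℤ.∣_)
    (solve 4 (λ i j k l → (i :- j) :+ (k :- l) := (i :+ k) :- (j :+ l)) refl i j k l)
    (∣m∣n⇒∣m+n p q)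
    where open ℤSolver.+-*-Solver

  *-cong2^ : ∀ {i j k l n} → i ≡ j [2^ n ] → k ≡ l [2^ n ] → i ℤ.* k ≡ j ℤ.* l [2^ n ]
  *-cong2^ {i} {j} {k} {l} {n} p q = subst ((+ (2 ℕ.^ n)) ℤ.∣_)
    (solve 4 (λ i j k l → (i :- j) :* k :+ j :* (k :- l) := i :* k :- j :* l) refl i j k l)
    (∣m∣n⇒∣m+n (∣m⇒∣m*n k p) (∣n⇒∣m*n j q))
    where open ℤSolver.+-*-Solver

  neg-cong2^ : ∀ {i j n} → i ≡ j [2^ n ] → ℤ.- i ≡ ℤ.- j [2^ n ]
  neg-cong2^ {i} {j} {n} p = subst ((+ (2 ℕ.^ n)) ℤ.∣_)
    (solve 2 (λ i j → :- (i :- j) := (:- i) :- (:- j)) refl i j) (∣m⇒∣-m p)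
    where open ℤSolver.+-*-Solver

fromℤ₂ : ℤ → ℤ₂
fromℤ₂ i = mkℤ₂ (λ _ → i) (≡2^-reflexive i)

_+ᶻ_ _*ᶻ_ : ℤ₂ → ℤ₂ → ℤ₂
mkℤ₂ x cx +ᶻ mkℤ₂ y cy = mkℤ₂ (λ n → x n ℤ.+ y n)
  (λ n → +-cong2^ {x (suc n)} {x n} {y (suc n)} {y n} {n} (cx n) (cy n))
mkℤ₂ x cx *ᶻ mkℤ₂ y cy = mkℤ₂ (λ n → x n ℤ.* y n)
  (λ n → *-cong2^ {x (suc n)} {x n} {y (suc n)} {y n} {n} (cx n) (cy n))

negᶻ : ℤ₂ → ℤ₂
negᶻ (mkℤ₂ x cx) = mkℤ₂ (λ n → ℤ.- x n) (λ n → neg-cong2^ {x (suc n)} {x n} {n} (cx n))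

_≈ᶻ_ : ℤ₂ → ℤ₂ → Set
x ≈ᶻ y = ∀ n → residue x n ≡ residue y n [2^ n ]

2^ᶻ : ℕ → ℤ₂
2^ᶻ k = fromℤ₂ (+ (2 ℕ.^ k))

-- x /2^ k stands for x / 2ᵏ, with x not necessarily odd.
record ℚ₂ : Set where
  constructor _/2^_
  field
    numerator : ℤ₂
    exponent  : ℕ

_≈₂_ : ℚ₂ → ℚ₂ → Set
(x /2^ k) ≈₂ (y /2^ l) = (x *ᶻ 2^ᶻ l) ≈ᶻ (y *ᶻ 2^ᶻ k)

ℚ₂-rawRing : RawRing 0ℓ 0ℓ
ℚ₂-rawRing = record
  { Carrier = ℚ₂
  ; _≈_ = _≈₂_
  ; _+_ = λ { (x /2^ k) (y /2^ l) → ((x *ᶻ 2^ᶻ l) +ᶻ (y *ᶻ 2^ᶻ k)) /2^ (k ℕ.+ l) }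
  ; _*_ = λ { (x /2^ k) (y /2^ l) → (x *ᶻ y) /2^ (k ℕ.+ l) }
  ; -_  = λ { (x /2^ k) → negᶻ x /2^ k }
  ; 0#  = fromℤ₂ (+ 0) /2^ 0
  ; 1#  = fromℤ₂ (+ 1) /2^ 0
  }

-- digit x j ∈ {0,1} is the coefficient of 2ʲ in the expansion of x.
digit : ℤ₂ → ℕ → ℕ
digit x j = residue x (suc j) %ℕ (2 ℕ.^ suc j) ℕ./ (2 ℕ.^ j)
  where
  instance
    _ = ℕ.m^n≢0 2 j
    _ = ℕ.m^n≢0 2 (suc j)

Σℚ≤ : ℕ → (ℕ → ℚ) → ℚ
Σℚ≤ zero    f = f 0
Σℚ≤ (suc k) f = Σℚ≤ k f ℚ.+ f (suc k)

-- The coefficient of 2ⁿ in x / 2ᵏ is digit x (n + k), so the sum over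
-- n ≤ 0 is the sum over j = n + k ≤ k of digit x j · 2ʲ / 2ᵏ.
⌊_⌋₂ : ℚ₂ → ℚ
⌊ x /2^ k ⌋₂ = Σℚ≤ k (λ j → (+ (digit x j ℕ.* 2 ℕ.^ j)) ℚ./ (2 ℕ.^ k))
  where instance _ = ℕ.m^n≢0 2 k

record QuadraticField : Set₁ where
  field
    commutativeRing : CommutativeRing 0ℓ 0ℓ

  open CommutativeRing commutativeRing public

  field
    1≉0     : ¬ (1# ≈ 0#)
    inverse : ∀ x → ¬ (x ≈ 0#) → ∃[ y ] (x * y ≈ 1#)

    ι                    : ℚ → Carrier
    ι-isRingHomomorphism : RingMorphisms.IsRingHomomorphism ℚ.+-*-rawRing rawRing ι

    -- (e₁ , e₂) is a basis over ℚ.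
    e₁ e₂       : Carrier
    spanning    : ∀ x → ∃₂ λ a b → x ≈ ι a * e₁ + ι b * e₂
    independent : ∀ a b → ι a * e₁ + ι b * e₂ ≈ 0# → a ≡ 0ℚ × b ≡ 0ℚ

record Embedding (K : QuadraticField) (L : RawRing 0ℓ 0ℓ) : Set where
  field
    ⟦_⟧                : QuadraticField.Carrier K → RawRing.Carrier L
    isRingMonomorphism : RingMorphisms.IsRingMonomorphism (QuadraticField.rawRing K) L ⟦_⟧

open Embedding public using (⟦_⟧)

IsSmallestMinimizer : (ℤ → ℝ) → ℤ → Set
IsSmallestMinimizer f m = Minimizes m × (∀ i → Minimizes i → m ℤ.≤ i)
  where
  Minimizes : ℤ → Set
  Minimizes i = ∀ j → f i ≤ᴿ f j

spacing : Parity → ℤ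
spacing 0ℙ = + 2
spacing 1ℙ = + 1

module Algorithm (K : QuadraticField)
                 (σ∞ : Embedding K ℝ-rawRing)
                 (σ₂ : Embedding K ℚ₂-rawRing) where

  open QuadraticField K

  -- IsPartialQuotient ϵ β b says that b = b⁽ᵋ⁾(β).
  IsPartialQuotient : Parity → Carrier → ℚ → Set
  IsPartialQuotient ϵ β b = ∃[ m ]
    (IsSmallestMinimizer (λ i → absᴿ (⟦ σ∞ ⟧ β -ᴿ fromℚ (candidate i))) m × b ≡ candidate m)
    where
    candidate : ℤ → ℚ
    candidate i = (spacing ϵ ℤ.* i) ℚ./ 1 ℚ.+ ⌊ ⟦ σ₂ ⟧ β ⌋₂

  -- IsNext β b γ says that β ≠ b and γ = 1 / (β - b).
  IsNext : Carrier → ℚ → Carrier → Set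
  IsNext β b γ = γ * (β - ι b) ≈ 1#

  record InfiniteRun (α : Carrier) : Set where
    field
      αₙ       : ℕ → Carrier
      bₙ       : ℕ → ℚ
      start    : αₙ 0 ≈ α
      quotient : ∀ n → IsPartialQuotient (parity n) (αₙ n) (bₙ n)
      next     : ∀ n → IsNext (αₙ n) (bₙ n) (αₙ (suc n))

  -- The values αₙ n and bₙ n for n > last are irrelevant.
  record HaltingRun (α : Carrier) : Set where
    field
      last     : ℕ
      αₙ       : ℕ → Carrier
      bₙ       : ℕ → ℚ
      start    : αₙ 0 ≈ α
      quotient : ∀ n → n ℕ.≤ last → IsPartialQuotient (parity n) (αₙ n) (bₙ n)
      next     : ∀ n → n ℕ.< last → IsNext (αₙ n) (bₙ n) (αₙ (suc n))
      halt     : αₙ last ≈ ι (bₙ last)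

open Algorithm public using (InfiniteRun; HaltingRun)

record Mat₂ : Set where
  constructor mat
  field
    e₁₁ e₁₂ e₂₁ e₂₂ : ℚ

infixl 7 _⊗_

_⊗_ : Mat₂ → Mat₂ → Mat₂
mat a b c d ⊗ mat a′ b′ c′ d′ = mat
  (a ℚ.* a′ ℚ.+ b ℚ.* c′) (a ℚ.* b′ ℚ.+ b ℚ.* d′)
  (c ℚ.* a′ ℚ.+ d ℚ.* c′) (c ℚ.* b′ ℚ.+ d ℚ.* d′)

convergentMatrix : (ℕ → ℚ) → ℕ → Mat₂
convergentMatrix b zero    = mat (b 0) 1ℚ 1ℚ 0ℚ
convergentMatrix b (suc n) = convergentMatrix b n ⊗ mat (b (suc n)) 1ℚ 1ℚ 0ℚ

p q : (ℕ → ℚ) → ℕ → ℚ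
p b n = Mat₂.e₁₁ (convergentMatrix b n)
q b n = Mat₂.e₂₁ (convergentMatrix b n)

convergent : (b : ℕ → ℚ) (n : ℕ) → q b n ≢ 0ℚ → ℚ
convergent b n qₙ≢0 = (p b n ℚ.÷ q b n) {{ℚ.≢-nonZero qₙ≢0}}

{-# OPTIONS --safe #-}
module Submission where

-- Write δₙ = αₙ - bₙ and eₙ = α qₙ - pₙ, so that eₙ = ± δ₀ ⋯ δₙ. The choice of bₙ gives
-- δₙ ∈ ℤ₂, δₙ ∈ 2ℤ₂ for even n, and |δₙ| ≤ 1 resp. ½ for even resp. odd n. Since
-- consecutive δ's have an even product, qₙ eₙ₋₁ is an odd 2-adic integer; hence qₙ ≠ 0,
-- eₙ₋₁ ≠ 0, and qₙ eₙ is integral. This gives eₙ → 0 in ℝ, but a priori qₙ could be small.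
-- The norm N of eₙ is p² - tpq + dq² = eₙ² - (2α - t) qₙ eₙ, which is nonzero, lies in
-- ℤ[1/2] up to a fixed denominator, and is 2-adically bounded. Hence a fixed multiple W N is a
-- nonzero integer, so 1 ≤ W (|eₙ|² + M |qₙ| |eₙ|), which forces |α - pₙ/qₙ| = O(|eₙ|²).

open import Defs
open import Level using (0ℓ)
open import Axiom.ExcludedMiddle using (ExcludedMiddle)
open import Data.Nat.Base using (ℕ)
open import Data.Product.Base using (_×_; Σ-syntax)
open import Data.Rational.Base using (0ℚ)
open import Relation.Binary.PropositionalEquality using (_≢_)

open import Algebra.Bundles using (RawRing)
open import Algebra.Morphism.Structures using (module RingMorphisms)
import Algebra.Properties.Ring
import Algebra.Solver.Ring
open import Algebra.Solver.Ring.AlmostCommutativeRing using (fromCommutativeRing; _-Raw-AlmostCommutative⟶_)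
open import Data.Integer.Base as ℤ using (ℤ; +_; -[1+_]; _%ℕ_)
import Data.Integer.DivMod as ℤ
open import Data.Integer.Divisibility.Signed as ℤ
  using (_∣_; divides; ∣-trans; ∣m∣n⇒∣m+n; ∣m∣n⇒∣m-n; ∣m⇒∣-m; ∣n⇒∣m*n; ∣m⇒∣m*n)
import Data.Integer.Properties as ℤ
open import Data.Integer.Solver as ℤSolver using ()
open import Data.Maybe.Base using (Maybe; just; nothing)
open import Data.Nat.Base as ℕ using (zero; suc; parity)
import Data.Nat.Divisibility as ℕ
import Data.Nat.DivMod as ℕ
import Data.Nat.Properties as ℕ
open import Data.Parity.Base using (Parity; 0ℙ; 1ℙ)
open import Data.Product.Base using (∃-syntax; _,_; proj₁; proj₂)
open import Data.Rational.Base as ℚ using (ℚ; 1ℚ; ½)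
import Data.Rational.Properties as ℚ
open import Data.Rational.Solver as ℚSolver using ()
open import Data.Rational.Unnormalised.Base as ℚᵘ using (mkℚᵘ; *≡*; *≤*)
import Data.Rational.Unnormalised.Properties as ℚᵘ
open import Data.Sum.Base using (_⊎_; inj₁; inj₂; [_,_]′)
open import Function.Base using (case_of_)
import Relation.Binary.Reasoning.Setoid
open import Relation.Binary.PropositionalEquality as ≡ using (_≡_; cong; cong₂; subst; subst₂)
open import Relation.Nullary using (¬_; contradiction; yes; no)

-- Integers and rationals

-- A product-formula argument replaces it: an element of ℤ[1/2] that is a 2-adic integer is an
-- ordinary integer, so if nonzero it has real absolute value at least 1. As eₙ lies in K and in
-- general not in ℚ, this is applied to its norm. The other factor of the norm is the conjugate eₙ -
-- (2α - t) qₙ, so only eₙ and qₙ eₙ enter. Both are 2-adically integral, while pₙ and qₙ themselves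
-- may have large powers of 2 in their denominators. The oddness of qₙ eₙ₋₁ comes from qₙ eₙ₋₁ -
-- qₙ₋₁ eₙ = ± 1, the determinant of the convergent matrix up to sign, together with the evenness of
-- qₙ₋₁ eₙ = qₙ₋₁ eₙ₋₂ δₙ₋₁ δₙ. The two spacings share the work: spacing 2 gains a factor 2 in ℚ₂
-- but only |δₙ| ≤ 1 in ℝ, spacing 1 gains a factor ½ in ℝ but only integrality in ℚ₂.

2ℚ : ℚ
2ℚ = 1ℚ ℚ.+ 1ℚ

fromℤ : ℤ → ℚ
fromℤ a = a ℚ./ 1

toℚᵘ-/ : ∀ a n → ℚ.toℚᵘ (a ℚ./ suc n) ℚᵘ.≃ mkℚᵘ a n
toℚᵘ-/ a n = ℚ.toℚᵘ-fromℚᵘ (mkℚᵘ a n)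

fromℤ-+ : ∀ a b → fromℤ (a ℤ.+ b) ≡ fromℤ a ℚ.+ fromℤ b
fromℤ-+ a b = ℚ.toℚᵘ-injective (begin
  ℚ.toℚᵘ (fromℤ (a ℤ.+ b))                 ≈⟨ toℚᵘ-/ (a ℤ.+ b) 0 ⟩
  mkℚᵘ (a ℤ.+ b) 0                         ≈⟨ *≡* (cong (ℤ._* ℤ.1ℤ) (≡.sym (cong₂ ℤ._+_ (ℤ.*-identityʳ a) (ℤ.*-identityʳ b)))) ⟩
  mkℚᵘ a 0 ℚᵘ.+ mkℚᵘ b 0                   ≈⟨ ℚᵘ.+-cong (toℚᵘ-/ a 0) (toℚᵘ-/ b 0) ⟨
  ℚ.toℚᵘ (fromℤ a) ℚᵘ.+ ℚ.toℚᵘ (fromℤ b)   ≈⟨ ℚ.toℚᵘ-homo-+ (fromℤ a) (fromℤ b) ⟨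
  ℚ.toℚᵘ (fromℤ a ℚ.+ fromℤ b)             ∎)
  where open ℚᵘ.≃-Reasoning

fromℤ-* : ∀ a b → fromℤ (a ℤ.* b) ≡ fromℤ a ℚ.* fromℤ b
fromℤ-* a b = ℚ.toℚᵘ-injective (begin
  ℚ.toℚᵘ (fromℤ (a ℤ.* b))                 ≈⟨ toℚᵘ-/ (a ℤ.* b) 0 ⟩
  mkℚᵘ a 0 ℚᵘ.* mkℚᵘ b 0                   ≈⟨ ℚᵘ.*-cong (toℚᵘ-/ a 0) (toℚᵘ-/ b 0) ⟨
  ℚ.toℚᵘ (fromℤ a) ℚᵘ.* ℚ.toℚᵘ (fromℤ b)   ≈⟨ ℚ.toℚᵘ-homo-* (fromℤ a) (fromℤ b) ⟨
  ℚ.toℚᵘ (fromℤ a ℚ.* fromℤ b)             ∎)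
  where open ℚᵘ.≃-Reasoning

/-*-cancel : ∀ a n .{{_ : ℕ.NonZero n}} → (a ℚ./ n) ℚ.* fromℤ (+ n) ≡ fromℤ a
/-*-cancel a (suc n) = ℚ.toℚᵘ-injective (begin
  ℚ.toℚᵘ ((a ℚ./ suc n) ℚ.* fromℤ (+ suc n))         ≈⟨ ℚ.toℚᵘ-homo-* (a ℚ./ suc n) (fromℤ (+ suc n)) ⟩
  ℚ.toℚᵘ (a ℚ./ suc n) ℚᵘ.* ℚ.toℚᵘ (fromℤ (+ suc n)) ≈⟨ ℚᵘ.*-cong (toℚᵘ-/ a n) (toℚᵘ-/ (+ suc n) 0) ⟩
  mkℚᵘ a n ℚᵘ.* mkℚᵘ (+ suc n) 0                     ≈⟨ *≡* (≡.trans (ℤ.*-identityʳ _) (cong (λ d → a ℤ.* + suc d) (≡.sym (ℕ.*-identityʳ n)))) ⟩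
  mkℚᵘ a 0                                           ≈⟨ toℚᵘ-/ a 0 ⟨
  ℚ.toℚᵘ (fromℤ a)                                   ∎)
  where open ℚᵘ.≃-Reasoning

*-↧≡↥ : ∀ x → x ℚ.* fromℤ (+ ℚ.↧ₙ x) ≡ fromℤ (ℚ.↥ x)
*-↧≡↥ x = ≡.trans (cong (ℚ._* fromℤ (+ ℚ.↧ₙ x)) (≡.sym (ℚ.↥p/↧p≡p x))) (/-*-cancel (ℚ.↥ x) (ℚ.↧ₙ x))

fromℤ-mono-≤ : ∀ {a b} → a ℤ.≤ b → fromℤ a ℚ.≤ fromℤ b
fromℤ-mono-≤ {a} {b} a≤b = ℚ.toℚᵘ-cancel-≤ (begin
  ℚ.toℚᵘ (fromℤ a) ≃⟨ toℚᵘ-/ a 0 ⟩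
  mkℚᵘ a 0         ≤⟨ *≤* (ℤ.*-monoʳ-≤-nonNeg ℤ.1ℤ a≤b) ⟩
  mkℚᵘ b 0         ≃⟨ toℚᵘ-/ b 0 ⟨
  ℚ.toℚᵘ (fromℤ b) ∎)
  where open ℚᵘ.≤-Reasoning

*-pos : ∀ {x y} → 0ℚ ℚ.< x → 0ℚ ℚ.< y → 0ℚ ℚ.< x ℚ.* y
*-pos {x} {y} x>0 y>0 =
  ℚ.positive⁻¹ (x ℚ.* y) {{ℚ.pos*pos⇒pos x {{ℚ.positive x>0}} y {{ℚ.positive y>0}}}}

*-nonNeg : ∀ {x y} → 0ℚ ℚ.≤ x → 0ℚ ℚ.≤ y → 0ℚ ℚ.≤ x ℚ.* y
*-nonNeg {x} {y} x≥0 y≥0 =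
  ℚ.nonNegative⁻¹ (x ℚ.* y) {{ℚ.nonNeg*nonNeg⇒nonNeg x {{ℚ.nonNegative x≥0}} y {{ℚ.nonNegative y≥0}}}}

*-monoˡ-≤ : ∀ {x y} z → 0ℚ ℚ.≤ z → x ℚ.≤ y → x ℚ.* z ℚ.≤ y ℚ.* z
*-monoˡ-≤ z z≥0 = ℚ.*-monoʳ-≤-nonNeg z {{ℚ.nonNegative z≥0}}

*-monoʳ-≤ : ∀ {x y} z → 0ℚ ℚ.≤ z → x ℚ.≤ y → z ℚ.* x ℚ.≤ z ℚ.* y
*-monoʳ-≤ z z≥0 = ℚ.*-monoˡ-≤-nonNeg z {{ℚ.nonNegative z≥0}}

∣x∣≤c : ∀ {x c} → x ℚ.≤ c → ℚ.- x ℚ.≤ c → ℚ.∣ x ∣ ℚ.≤ c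
∣x∣≤c {x} {c} x≤c -x≤c with ℚ.∣p∣≡p∨∣p∣≡-p x
... | inj₁ e = subst (ℚ._≤ c) (≡.sym e) x≤c
... | inj₂ e = subst (ℚ._≤ c) (≡.sym e) -x≤c

x≤∣x∣ : ∀ x → x ℚ.≤ ℚ.∣ x ∣
x≤∣x∣ x with ℚ.≤-total 0ℚ x
... | inj₁ x≥0 = ℚ.≤-reflexive (≡.sym (ℚ.0≤p⇒∣p∣≡p x≥0))
... | inj₂ x≤0 = ℚ.≤-trans x≤0 (ℚ.0≤∣p∣ x)

-- Discreteness of ℤ is the source of the lower bound 1 in `norm-bound`.
1≤∣fromℤ∣ : ∀ {a} → a ≢ ℤ.0ℤ → 1ℚ ℚ.≤ ℚ.∣ fromℤ a ∣
1≤∣fromℤ∣ {+ zero}  a≢0 = contradiction ≡.refl a≢0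
1≤∣fromℤ∣ {+ suc n} _   = ℚ.≤-trans (fromℤ-mono-≤ {ℤ.1ℤ} {+ suc n} (ℤ.+≤+ (ℕ.s≤s ℕ.z≤n))) (x≤∣x∣ _)
1≤∣fromℤ∣ { -[1+ n ]} _ = subst (1ℚ ℚ.≤_) (≡.sym (ℚ.∣-p∣≡∣p∣ (fromℤ (+ suc n)))) (1≤∣fromℤ∣ {+ suc n} λ ())

-- The denominator of `η` serves as `n`: the product is the numerator, a positive integer.
archimedean : ∀ {η} → 0ℚ ℚ.< η → ∃[ n ] 1ℚ ℚ.≤ fromℤ (+ n) ℚ.* η
archimedean {η@record{}} η>0 = ℚ.↧ₙ η , (begin
  1ℚ                                        ≤⟨ fromℤ-mono-≤ (ℤ.i<j⇒suc[i]≤j (ℤ.positive⁻¹ (ℚ.↥ η) {{ℚ.positive η>0}})) ⟩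
  fromℤ (ℚ.↥ η)                             ≡⟨ /-*-cancel (ℚ.↥ η) (ℚ.↧ₙ η) ⟨
  (ℚ.↥ η ℚ./ ℚ.↧ₙ η) ℚ.* fromℤ (+ ℚ.↧ₙ η)   ≡⟨ cong (ℚ._* fromℤ (+ ℚ.↧ₙ η)) (ℚ.↥p/↧p≡p η) ⟩
  η ℚ.* fromℤ (+ ℚ.↧ₙ η)                    ≡⟨ ℚ.*-comm η (fromℤ (+ ℚ.↧ₙ η)) ⟩
  fromℤ (+ ℚ.↧ₙ η) ℚ.* η                    ∎)
  where open ℚ.≤-Reasoning

floor-≤ : ∀ s → fromℤ (ℚ.floor s) ℚ.≤ s
floor-≤ s@record{} = ℚ.toℚᵘ-cancel-≤ (begin
  ℚ.toℚᵘ (fromℤ (ℚ.floor s))  ≃⟨ toℚᵘ-/ (ℚ.floor s) 0 ⟩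
  mkℚᵘ (ℚ.floor s) 0          ≤⟨ *≤* (ℤ.≤-trans (ℤ.[n/d]*d≤n (ℚ.↥ s) (ℚ.↧ s)) (ℤ.≤-reflexive (≡.sym (ℤ.*-identityʳ _)))) ⟩
  ℚ.toℚᵘ s                    ∎)
  where open ℚᵘ.≤-Reasoning

≤-suc-floor : ∀ s → s ℚ.≤ 1ℚ ℚ.+ fromℤ (ℚ.floor s)
≤-suc-floor s@record{} = subst (s ℚ.≤_) (fromℤ-+ ℤ.1ℤ (ℚ.floor s)) (ℚ.toℚᵘ-cancel-≤ (begin
  ℚ.toℚᵘ s                             ≤⟨ *≤* (ℤ.≤-trans (ℤ.≤-reflexive (ℤ.*-identityʳ _)) (ℤ.<⇒≤ n<)) ⟩
  mkℚᵘ (ℤ.suc (ℚ.floor s)) 0           ≃⟨ toℚᵘ-/ (ℤ.suc (ℚ.floor s)) 0 ⟨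
  ℚ.toℚᵘ (fromℤ (ℤ.suc (ℚ.floor s)))   ∎))
  where
  open ℚᵘ.≤-Reasoning
  n< : ℚ.↥ s ℤ.< ℤ.suc (ℚ.floor s) ℤ.* ℚ.↧ s
  n< = subst (λ t → ℚ.↥ s ℤ.< ℤ.suc t ℤ.* ℚ.↧ s) (≡.sym (ℤ.div-pos-is-/ℕ (ℚ.↥ s) (ℚ.↧ₙ s))) (ℤ.n<s[n/ℕd]*d (ℚ.↥ s) (ℚ.↧ₙ s))

nearestInteger : ∀ t → ∃[ j ] ℚ.∣ t ℚ.- fromℤ j ∣ ℚ.≤ ½
nearestInteger t = j , ∣x∣≤c
    (subst₂ ℚ._≤_ (solve 2 (λ t j → (t :+ con ½) :+ (:- con ½ :- j) := t :- j) ≡.refl t (fromℤ j))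
                  (solve 1 (λ j → (con 1ℚ :+ j) :+ (:- con ½ :- j) := con ½) ≡.refl (fromℤ j))
                  (ℚ.+-monoˡ-≤ (ℚ.- ½ ℚ.- fromℤ j) (≤-suc-floor (t ℚ.+ ½))))
    (subst₂ ℚ._≤_ (solve 2 (λ t j → j :- t := :- (t :- j)) ≡.refl t (fromℤ j))
                  (solve 1 (λ t → t :+ con ½ :- t := con ½) ≡.refl t)
                  (ℚ.+-monoˡ-≤ (ℚ.- t) (floor-≤ (t ℚ.+ ½))))
  where
  open ℚSolver.+-*-Solver
  j = ℚ.floor (t ℚ.+ ½)

-- Congruences in ℚ₂

module Q₂ = RawRing ℚ₂-rawRing

2^ : ℕ → ℤ
2^ n = + (2 ℕ.^ n)

2^-+ : ∀ m n → 2^ (m ℕ.+ n) ≡ 2^ m ℤ.* 2^ n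
2^-+ m n = ≡.trans (cong +_ (ℕ.^-distribˡ-+-* 2 m n)) (ℤ.pos-* (2 ℕ.^ m) (2 ℕ.^ n))

2^-nonZero : ∀ n → ℤ.NonZero (2^ n)
2^-nonZero n = ℕ.m^n≢0 2 n

2^-mono : ∀ {m n} → m ℕ.≤ n → 2^ m ∣ 2^ n
2^-mono {m} {n} m≤n = divides (2^ (n ℕ.∸ m)) (≡.trans (cong 2^ (≡.sym (ℕ.m∸n+n≡m m≤n))) (2^-+ (n ℕ.∸ m) m))

∣-respʳ : ∀ {k i j} → i ≡ j → k ∣ i → k ∣ j
∣-respʳ {k} = subst (k ∣_)

∣-respˡ : ∀ {i j k} → i ≡ j → i ∣ k → j ∣ k
∣-respˡ {k = k} = subst (_∣ k)

*-mono-∣ : ∀ {i j k l} → i ∣ j → k ∣ l → i ℤ.* k ∣ j ℤ.* l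
*-mono-∣ {i} {j} {k} {l} i∣j k∣l = ∣-trans (ℤ.*-monoˡ-∣ k i∣j) (ℤ.*-monoʳ-∣ j k∣l)

residue-≤ : ∀ u {m n} → m ℕ.≤ n → residue u n ≡ residue u m [2^ m ]
residue-≤ u {m} {n} m≤n =
  subst (λ n → residue u n ≡ residue u m [2^ m ]) (ℕ.m∸n+n≡m m≤n) (go (n ℕ.∸ m))
  where
  open ℤSolver.+-*-Solver
  go : ∀ d → residue u (d ℕ.+ m) ≡ residue u m [2^ m ]
  go zero    = divides ℤ.0ℤ (ℤ.+-inverseʳ (residue u m))
  go (suc d) = ∣-respʳ
    (solve 3 (λ a b c → (a :- b) :+ (b :- c) := a :- c) ≡.refl
      (residue u (suc d ℕ.+ m)) (residue u (d ℕ.+ m)) (residue u m))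
    (∣m∣n⇒∣m+n (∣-trans (2^-mono (ℕ.m≤n+m m d)) (coherent u (d ℕ.+ m))) (go d))

-- x ≡ a / 2ʲ modulo 2ᵛ ℤ₂, with denominators cleared.
Congruent : ℕ → ℕ → ℚ₂ → ℤ → Set
Congruent v j (u /2^ l) a = ∀ n → v ℕ.+ l ℕ.+ j ℕ.≤ n →
  2^ v ℤ.* 2^ l ℤ.* 2^ j ∣ 2^ j ℤ.* residue u n ℤ.- a ℤ.* 2^ l

Val≥ : ℕ → ℚ₂ → Set
Val≥ v x = Congruent v 0 x ℤ.0ℤ

module _ where
  open ℤSolver.+-*-Solver

  2^-+-+ : ∀ v l j → 2^ (v ℕ.+ l ℕ.+ j) ≡ 2^ v ℤ.* 2^ l ℤ.* 2^ j
  2^-+-+ v l j = ≡.trans (2^-+ (v ℕ.+ l) j) (cong (ℤ._* 2^ j) (2^-+ v l))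

  -- All residues of index at least v + l + j agree modulo 2^(v + l + j), the modulus of the
  -- divisibility, so a single index decides.
  congruent-at : ∀ v j u l a {m} → v ℕ.+ l ℕ.+ j ℕ.≤ m →
    2^ v ℤ.* 2^ l ℤ.* 2^ j ∣ 2^ j ℤ.* residue u m ℤ.- a ℤ.* 2^ l → Congruent v j (u /2^ l) a
  congruent-at v j u l a {m} m≥ h n n≥ = ∣-respʳ
    (solve 6 (λ J x y z a L → J :* (x :- z) :- J :* (y :- z) :+ (J :* y :- a :* L) := J :* x :- a :* L) ≡.refl
      (2^ j) (residue u n) (residue u m) (residue u (v ℕ.+ l ℕ.+ j)) a (2^ l))
    (∣m∣n⇒∣m+n (∣m∣n⇒∣m-n (∣n⇒∣m*n (2^ j) (close n≥)) (∣n⇒∣m*n (2^ j) (close m≥))) h)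
    where
    close : ∀ {n} → v ℕ.+ l ℕ.+ j ℕ.≤ n →
      2^ v ℤ.* 2^ l ℤ.* 2^ j ∣ residue u n ℤ.- residue u (v ℕ.+ l ℕ.+ j)
    close n≥ = ∣-respˡ (2^-+-+ v l j) (residue-≤ u n≥)

  congruent-resp : ∀ {v j a} x y → x ≈₂ y → Congruent v j x a → Congruent v j y a
  congruent-resp {v} {j} {a} (u /2^ k) (w /2^ l) x≈y h = congruent-at v j w l a {k ℕ.+ n₀} (ℕ.m≤n+m n₀ k)
    (ℤ.*-cancelʳ-∣ (2^ k) {{2^-nonZero k}} (∣-respʳ
      (solve 7 (λ J L K x y a o → J :* (:- (x :* L :- y :* K)) :+ (J :* x :- a :* K) :* L
                                := (J :* y :- a :* L) :* K) ≡.refl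
        (2^ j) (2^ l) (2^ k) (residue u m) (residue w m) a a)
      (∣m∣n⇒∣m+n
        (∣n⇒∣m*n (2^ j) (∣m⇒∣-m (∣-respˡ e (x≈y m))))
        (∣-respˡ (solve 4 (λ V K J L → V :* K :* J :* L := V :* L :* J :* K) ≡.refl (2^ v) (2^ k) (2^ j) (2^ l))
          (ℤ.*-monoˡ-∣ (2^ l) (h m m≥))))))
    where
    n₀ = v ℕ.+ l ℕ.+ j
    m = k ℕ.+ (v ℕ.+ l ℕ.+ j)
    e : 2^ m ≡ 2^ v ℤ.* 2^ l ℤ.* 2^ j ℤ.* 2^ k
    e = ≡.trans (cong 2^ (ℕ.+-comm k n₀)) (≡.trans (2^-+ n₀ k) (cong (ℤ._* 2^ k) (2^-+-+ v l j)))
    m≥ : v ℕ.+ k ℕ.+ j ℕ.≤ m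
    m≥ = ℕ.≤-trans (ℕ.≤-reflexive (≡.trans (cong (ℕ._+ j) (ℕ.+-comm v k)) (ℕ.+-assoc k v j)))
           (ℕ.+-monoʳ-≤ k (ℕ.+-monoˡ-≤ j (ℕ.m≤m+n v l)))

  congruent-+ : ∀ {v j a b} x y → Congruent v j x a → Congruent v j y b →
    Congruent v j (x Q₂.+ y) (a ℤ.+ b)
  congruent-+ {v} {j} {a} {b} (u /2^ k) (w /2^ l) hx hy n n≥ = subst₂ _∣_
    (≡.trans (solve 4 (λ V K J L → V :* K :* J :* L := V :* (K :* L) :* J) ≡.refl (2^ v) (2^ k) (2^ j) (2^ l))
      (cong (λ t → 2^ v ℤ.* t ℤ.* 2^ j) (≡.sym (2^-+ k l))))
    (≡.trans (solve 7 (λ J x y a b K L → (J :* x :- a :* K) :* L :+ (J :* y :- b :* L) :* K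
                                     := J :* (x :* L :+ y :* K) :- (a :+ b) :* (K :* L)) ≡.refl
              (2^ j) (residue u n) (residue w n) a b (2^ k) (2^ l))
      (cong (λ t → 2^ j ℤ.* (residue u n ℤ.* 2^ l ℤ.+ residue w n ℤ.* 2^ k) ℤ.- (a ℤ.+ b) ℤ.* t) (≡.sym (2^-+ k l))))
    (∣m∣n⇒∣m+n
      (ℤ.*-monoˡ-∣ (2^ l) (hx n (ℕ.≤-trans (ℕ.+-monoˡ-≤ j (ℕ.+-monoʳ-≤ v (ℕ.m≤m+n k l))) n≥)))
      (∣-respˡ (solve 4 (λ V K J L → V :* L :* J :* K := V :* K :* J :* L) ≡.refl (2^ v) (2^ k) (2^ j) (2^ l))
        (ℤ.*-monoˡ-∣ (2^ k) (hy n (ℕ.≤-trans (ℕ.+-monoˡ-≤ j (ℕ.+-monoʳ-≤ v (ℕ.m≤n+m l k))) n≥)))))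

  congruent-neg : ∀ {v j a} x → Congruent v j x a → Congruent v j (Q₂.- x) (ℤ.- a)
  congruent-neg {v} {j} {a} (u /2^ l) h n n≥ = ∣-respʳ
    (solve 4 (λ J x a L → :- (J :* x :- a :* L) := J :* (:- x) :- (:- a) :* L) ≡.refl (2^ j) (residue u n) a (2^ l))
    (∣m⇒∣-m (h n n≥))

  congruent-1 : ∀ v → Congruent v 0 Q₂.1# (+ 1)
  congruent-1 v n _ = divides ℤ.0ℤ ≡.refl

  congruent-weaken : ∀ {v w j a} x → w ℕ.≤ v → Congruent v j x a → Congruent w j x a
  congruent-weaken {v} {w} {j} {a} (u /2^ l) w≤v h =
    congruent-at w j u l a (ℕ.+-monoˡ-≤ j (ℕ.+-monoˡ-≤ l w≤v))
      (∣-trans (ℤ.*-monoˡ-∣ (2^ j) (ℤ.*-monoˡ-∣ (2^ l) (2^-mono w≤v))) (h (v ℕ.+ l ℕ.+ j) ℕ.≤-refl))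

  -- Halving costs one power of 2 in the modulus. The sum `x Q₂.+ x` is represented over 2^(l + l)
  -- rather than 2^l, hence the cancelled factor 2^l.
  congruent-halve : ∀ {v j a} x → Congruent (suc v) j (x Q₂.+ x) a → Congruent v (suc j) x a
  congruent-halve {v} {j} {a} (u /2^ l) h = congruent-at v (suc j) u l a {m} m≥
    (ℤ.*-cancelʳ-∣ (2^ l) {{2^-nonZero l}} (subst₂ _∣_
      (≡.trans (cong₂ (λ s t → s ℤ.* t ℤ.* 2^ j) (2^-+ 1 v) (2^-+ l l))
        (≡.trans (solve 3 (λ V L J → con (+ 2) :* V :* (L :* L) :* J := V :* L :* (con (+ 2) :* J) :* L) ≡.refl (2^ v) (2^ l) (2^ j))
          (cong (λ t → 2^ v ℤ.* 2^ l ℤ.* t ℤ.* 2^ l) (≡.sym (2^-+ 1 j)))))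
      (≡.trans (cong (λ t → 2^ j ℤ.* (residue u m ℤ.* 2^ l ℤ.+ residue u m ℤ.* 2^ l) ℤ.- a ℤ.* t) (2^-+ l l))
        (≡.trans (solve 4 (λ J x a L → J :* (x :* L :+ x :* L) :- a :* (L :* L) := (con (+ 2) :* J :* x :- a :* L) :* L) ≡.refl
                 (2^ j) (residue u m) a (2^ l))
          (cong (λ t → (t ℤ.* residue u m ℤ.- a ℤ.* 2^ l) ℤ.* 2^ l) (≡.sym (2^-+ 1 j)))))
      (h m ℕ.≤-refl)))
    where
    m = suc v ℕ.+ (l ℕ.+ l) ℕ.+ j
    m≥ : v ℕ.+ l ℕ.+ suc j ℕ.≤ m
    m≥ = ℕ.≤-trans (ℕ.≤-reflexive (ℕ.+-suc (v ℕ.+ l) j)) (ℕ.s≤s (ℕ.+-monoˡ-≤ j (ℕ.+-monoʳ-≤ v (ℕ.m≤m+n l l))))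

  val-* : ∀ {v w} x y → Val≥ v x → Val≥ w y → Val≥ (v ℕ.+ w) (x Q₂.* y)
  val-* {v} {w} (u /2^ k) (z /2^ l) hx hy n n≥ = subst₂ _∣_
    (≡.trans (solve 4 (λ V W K L → (V :* K :* con (+ 1)) :* (W :* L :* con (+ 1)) := (V :* W) :* (K :* L) :* con (+ 1)) ≡.refl (2^ v) (2^ w) (2^ k) (2^ l))
      (cong₂ (λ s t → s ℤ.* t ℤ.* + 1) (≡.sym (2^-+ v w)) (≡.sym (2^-+ k l))))
    (solve 5 (λ x y K L KL → (con (+ 1) :* x :- con (+ 0) :* K) :* (con (+ 1) :* y :- con (+ 0) :* L)
                           := con (+ 1) :* (x :* y) :- con (+ 0) :* KL) ≡.refl
       (residue u n) (residue z n) (2^ k) (2^ l) (2^ (k ℕ.+ l)))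
    (*-mono-∣ (hx n (ℕ.≤-trans (ℕ.+-monoˡ-≤ 0 (ℕ.+-mono-≤ (ℕ.m≤m+n v w) (ℕ.m≤m+n k l))) n≥))
              (hy n (ℕ.≤-trans (ℕ.+-monoˡ-≤ 0 (ℕ.+-mono-≤ (ℕ.m≤n+m w v) (ℕ.m≤n+m l k))) n≥)))

  -- The divisibility of `x` cancels the denominator of `y`, and the numerator of `y` lies in ℤ₂
  -- whatever `y` is.
  val-*-exponent : ∀ x y → Val≥ (ℚ₂.exponent y) x → Val≥ 0 (x Q₂.* y)
  val-*-exponent (u /2^ k) (z /2^ l) h n n≥ = ∣-respʳ
    (solve 4 (λ x y K KL → (con (+ 1) :* x :- con (+ 0) :* K) :* y := con (+ 1) :* (x :* y) :- con (+ 0) :* KL) ≡.refl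
       (residue u n) (residue z n) (2^ k) (2^ (k ℕ.+ l)))
    (∣m⇒∣m*n (residue z n) (∣-respˡ
      (≡.trans (solve 2 (λ K L → L :* K :* con (+ 1) := con (+ 1) :* (K :* L) :* con (+ 1)) ≡.refl (2^ k) (2^ l))
        (cong (λ t → + 1 ℤ.* t ℤ.* + 1) (≡.sym (2^-+ k l))))
      (h n (ℕ.≤-trans (ℕ.+-monoˡ-≤ 0 (ℕ.≤-reflexive (ℕ.+-comm l k))) n≥))))

  -- To know u / 2^k modulo 2 is to know `u` modulo 2^(k + 1), the information held by residue k +
  -- 1.
  congruent-residue : ∀ u k → Congruent 1 k (u /2^ k) (residue u (suc k))
  congruent-residue u k = congruent-at 1 k u k (residue u (suc k)) ℕ.≤-refl (subst₂ _∣_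
    (cong (ℤ._* 2^ k) (2^-+ 1 k))
    (solve 3 (λ x y K → (x :- y) :* K := K :* x :- y :* K) ≡.refl
      (residue u (1 ℕ.+ k ℕ.+ k)) (residue u (suc k)) (2^ k))
    (ℤ.*-monoˡ-∣ (2^ k) (residue-≤ u (ℕ.m≤m+n (suc k) k))))

  congruent⇒val : ∀ {v j a} x → Congruent v j x a → 2^ v ℤ.* 2^ j ∣ a → Val≥ v x
  congruent⇒val {v} {j} {a} (u /2^ l) h d = congruent-at v 0 u l ℤ.0ℤ {m}
    (ℕ.+-monoʳ-≤ (v ℕ.+ l) ℕ.z≤n)
    (ℤ.*-cancelʳ-∣ (2^ j) {{2^-nonZero j}} (subst₂ _∣_
      (solve 3 (λ V L J → V :* L :* J := V :* L :* con (+ 1) :* J) ≡.refl (2^ v) (2^ l) (2^ j))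
      (solve 4 (λ J x a L → (J :* x :- a :* L) :+ a :* L := (con (+ 1) :* x :- con (+ 0) :* L) :* J) ≡.refl
        (2^ j) (residue u m) a (2^ l))
      (∣m∣n⇒∣m+n (h m ℕ.≤-refl)
        (∣-respˡ (solve 3 (λ V J L → V :* J :* L := V :* L :* J) ≡.refl (2^ v) (2^ j) (2^ l)) (ℤ.*-monoˡ-∣ (2^ l) d)))))
    where m = v ℕ.+ l ℕ.+ j

  val⇒∣ : ∀ {v j a} x → Congruent v j x a → Val≥ v x → 2^ v ℤ.* 2^ j ∣ a
  val⇒∣ {v} {j} {a} (u /2^ l) h hv = ℤ.*-cancelʳ-∣ (2^ l) {{2^-nonZero l}} (subst₂ _∣_
    (solve 3 (λ V L J → V :* L :* J := V :* J :* L) ≡.refl (2^ v) (2^ l) (2^ j))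
    (solve 4 (λ J x a L → (con (+ 1) :* x :- con (+ 0) :* L) :* J :- (J :* x :- a :* L) := a :* L) ≡.refl
        (2^ j) (residue u m) a (2^ l))
    (∣m∣n⇒∣m-n
      (∣-respˡ (solve 3 (λ V J L → V :* L :* con (+ 1) :* J := V :* L :* J) ≡.refl (2^ v) (2^ j) (2^ l))
        (ℤ.*-monoˡ-∣ (2^ j) (hv m (ℕ.+-monoʳ-≤ (v ℕ.+ l) ℕ.z≤n))))
      (h m ℕ.≤-refl)))
    where m = v ℕ.+ l ℕ.+ j

-- Binary digits and the truncation `⌊_⌋₂`

remainder-unique : ∀ {d m n} → m ℕ.< d → n ℕ.< d → + d ∣ + m ℤ.- + n → m ≡ n
remainder-unique {d} {m} {n} m<d n<d d∣m-n = case ℕ.≤-total n m of λ where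
    (inj₁ n≤m) → ordered n≤m m<d d∣m-n
    (inj₂ m≤n) → ≡.sym (ordered m≤n n<d (∣-respʳ (solve 2 (λ m n → :- (m :- n) := n :- m) ≡.refl (+ m) (+ n)) (∣m⇒∣-m d∣m-n)))
  where
  open ℤSolver.+-*-Solver
  ordered : ∀ {m n} → n ℕ.≤ m → m ℕ.< d → + d ∣ + m ℤ.- + n → m ≡ n
  ordered {m} {n} n≤m m<d d∣ with m ℕ.∸ n in e | ℤ.∣⇒∣ᵤ (∣-respʳ (≡.trans (ℤ.m-n≡m⊖n m n) (ℤ.⊖-≥ n≤m)) d∣)
  ... | zero  | _   = ℕ.≤-antisym (ℕ.m∸n≡0⇒m≤n e) n≤m
  ... | suc k | d∣k = contradiction d∣k
    (ℕ.>⇒∤ (ℕ.≤-<-trans (subst (ℕ._≤ m) e (ℕ.m∸n≤m m n)) m<d))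

%ℕ-congruent : ∀ i d .{{_ : ℕ.NonZero d}} → + d ∣ i ℤ.- + (i %ℕ d)
%ℕ-congruent i d = divides (i ℤ./ℕ d)
  (≡.trans (cong (ℤ._- + (i %ℕ d)) (ℤ.a≡a%ℕn+[a/ℕn]*n i d))
    (solve 2 (λ r x → r :+ x :- r := x) ≡.refl (+ (i %ℕ d)) (i ℤ./ℕ d ℤ.* + d)))
  where open ℤSolver.+-*-Solver

Σℕ≤ : ℕ → (ℕ → ℕ) → ℕ
Σℕ≤ zero    f = f 0
Σℕ≤ (suc k) f = Σℕ≤ k f ℕ.+ f (suc k)

Σℚ≤-/ : ∀ d .{{_ : ℕ.NonZero d}} (f : ℕ → ℕ) k →
  Σℚ≤ k (λ j → (+ f j) ℚ./ d) ℚ.* fromℤ (+ d) ≡ fromℤ (+ Σℕ≤ k f)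
Σℚ≤-/ d f zero    = /-*-cancel (+ f 0) d
Σℚ≤-/ d f (suc k) = ≡.trans (ℚ.*-distribʳ-+ (fromℤ (+ d)) (Σℚ≤ k (λ j → (+ f j) ℚ./ d)) _)
  (≡.trans (cong₂ ℚ._+_ (Σℚ≤-/ d f k) (/-*-cancel (+ f (suc k)) d)) (≡.sym (fromℤ-+ (+ Σℕ≤ k f) (+ f (suc k)))))

-- Induction on `k`: the remainder modulo 2^(k + 2) splits into its own remainder modulo 2^(k + 1)
-- and its top digit. Each digit is read off a different residue, so the lower part has to be
-- matched with the previous remainder; this is `same`, a consequence of coherence.
Σ-digits : ∀ u k → Σℕ≤ k (λ j → digit u j ℕ.* 2 ℕ.^ j) ≡ (residue u (suc k) %ℕ 2 ℕ.^ suc k) {{ℕ.m^n≢0 2 (suc k)}}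
Σ-digits u zero    = ≡.trans (ℕ.*-identityʳ _) (ℕ.n/1≡n _)
Σ-digits u (suc k) = ≡.trans (cong (ℕ._+ R ℕ./ d ℕ.* d) (≡.trans (Σ-digits u k) same)) (≡.sym (ℕ.m≡m%n+[m/n]*n R d))
  where
  open ℤSolver.+-*-Solver
  d = 2 ℕ.^ suc k
  instance
    d≢0 = ℕ.m^n≢0 2 (suc k)
    2d≢0 = ℕ.m^n≢0 2 (suc (suc k))
  x = residue u (suc k)
  y = residue u (suc (suc k))
  R = y %ℕ 2 ℕ.^ suc (suc k)
  same : x %ℕ d ≡ R ℕ.% d
  same = remainder-unique (ℤ.n%ℕd<d x d) (ℕ.m%n<n R d) (∣-respʳ
    (solve 5 (λ x y R s t → (R :- t) :+ (y :- R) :- (x :- s) :- (y :- x) := s :- t) ≡.refl x y (+ R) (+ (x %ℕ d)) (+ (R ℕ.% d)))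
    (∣m∣n⇒∣m-n (∣m∣n⇒∣m-n (∣m∣n⇒∣m+n (%ℕ-congruent (+ R) d)
       (∣-trans (2^-mono (ℕ.n≤1+n (suc k))) (%ℕ-congruent y (2 ℕ.^ suc (suc k)))))
       (%ℕ-congruent x d)) (coherent u (suc k))))

-- The congruence is modulo 2^(k + 1) and not just 2^k because the truncation keeps the digit of
-- index 0. It makes x - ⌊x⌋₂ an element of 2ℤ₂.
⌊⌋₂-numerator : ∀ x → let open ℚ₂ x renaming (numerator to u; exponent to k) in
  ∃[ t ] (⌊ x ⌋₂ ℚ.* fromℤ (2^ k) ≡ fromℤ t × 2^ (suc k) ∣ residue u (suc k) ℤ.- t)
⌊⌋₂-numerator (u /2^ k) = + Σℕ≤ k (λ j → digit u j ℕ.* 2 ℕ.^ j)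
  , Σℚ≤-/ (2 ℕ.^ k) (λ j → digit u j ℕ.* 2 ℕ.^ j) k
  , ∣-respʳ (cong (λ t → residue u (suc k) ℤ.- + t) (≡.sym (Σ-digits u k))) (%ℕ-congruent (residue u (suc k)) (2 ℕ.^ suc k))
  where instance
    _ = ℕ.m^n≢0 2 k
    _ = ℕ.m^n≢0 2 (suc k)

≈₂-sym : ∀ x y → x ≈₂ y → y ≈₂ x
≈₂-sym (u /2^ k) (w /2^ l) h n = ∣-respʳ
  (solve 2 (λ s t → :- (s :- t) := t :- s) ≡.refl (residue u n ℤ.* 2^ l) (residue w n ℤ.* 2^ k)) (∣m⇒∣-m (h n))
  where open ℤSolver.+-*-Solver

-- Bounds in ℝ

½*-pos : ∀ {ε} → 0ℚ ℚ.< ε → 0ℚ ℚ.< ½ ℚ.* ε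
½*-pos = *-pos (ℚ.positive⁻¹ ½)

½+½ : ∀ ε → ½ ℚ.* ε ℚ.+ ½ ℚ.* ε ≡ ε
½+½ = solve 1 (λ ε → con ½ :* ε :+ con ½ :* ε := ε) ≡.refl
  where open ℚSolver.+-*-Solver

≤-of-<+ε : ∀ {x y} → (∀ ε → 0ℚ ℚ.< ε → x ℚ.< y ℚ.+ ε) → x ℚ.≤ y
≤-of-<+ε {x} {y} h = ℚ.≮⇒≥ λ y<x → ℚ.<-irrefl (solve 2 (λ x y → x := y :+ (x :- y)) ≡.refl x y)
  (h (x ℚ.- y) (subst (ℚ._< x ℚ.- y) (ℚ.+-inverseʳ y) (ℚ.+-monoˡ-< (ℚ.- y) y<x)))
  where open ℚSolver.+-*-Solver

-- The witness is the minimum of 1 and ε / B; the bound `η ≤ 1` allows `bound-*` to absorb η² into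
-- η.
scaleBelow : ∀ {B ε} → 0ℚ ℚ.< B → 0ℚ ℚ.< ε → ∃[ η ] (0ℚ ℚ.< η × η ℚ.≤ 1ℚ × B ℚ.* η ℚ.≤ ε)
scaleBelow {B} {ε} B>0 ε>0 = 1ℚ ℚ.⊓ δ
  , positive
  , ℚ.p⊓q≤p 1ℚ δ
  , ℚ.≤-trans (*-monoʳ-≤ B (ℚ.<⇒≤ B>0) (ℚ.p⊓q≤q 1ℚ δ)) (ℚ.≤-reflexive Bδ)
  where
  instance
    B-pos : ℚ.Positive B
    B-pos = ℚ.positive B>0
    B≢0 : ℚ.NonZero B
    B≢0 = ℚ.pos⇒nonZero B
  δ = ℚ.1/ B ℚ.* ε
  δ>0 : 0ℚ ℚ.< δ
  δ>0 = *-pos (ℚ.positive⁻¹ (ℚ.1/ B) {{ℚ.1/pos⇒pos B}}) ε>0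
  positive : 0ℚ ℚ.< 1ℚ ℚ.⊓ δ
  positive with ℚ.⊓-sel 1ℚ δ
  ... | inj₁ e = subst (0ℚ ℚ.<_) (≡.sym e) (ℚ.positive⁻¹ 1ℚ)
  ... | inj₂ e = subst (0ℚ ℚ.<_) (≡.sym e) δ>0
  Bδ : B ℚ.* δ ≡ ε
  Bδ = ≡.trans (≡.sym (ℚ.*-assoc B (ℚ.1/ B) ε)) (≡.trans (cong (ℚ._* ε) (ℚ.*-inverseʳ B)) (ℚ.*-identityˡ ε))

Eventually : (ℕ → Set) → Set
Eventually P = ∃[ N ] (∀ n → N ℕ.≤ n → P n)

eventually-map : ∀ {P Q : ℕ → Set} → (∀ n → P n → Q n) → Eventually P → Eventually Q
eventually-map f (N , h) = N , λ n n≥ → f n (h n n≥)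

eventually-zip : ∀ {P Q R : ℕ → Set} → (∀ n → P n → Q n → R n) →
  Eventually P → Eventually Q → Eventually R
eventually-zip f (M , g) (N , h) = M ℕ.⊔ N , λ n n≥ →
  f n (g n (ℕ.m⊔n≤o⇒m≤o M N n≥)) (h n (ℕ.m⊔n≤o⇒n≤o M N n≥))

∣x-z∣≤ : ∀ x y z → ℚ.∣ x ℚ.- z ∣ ℚ.≤ ℚ.∣ x ℚ.- y ∣ ℚ.+ ℚ.∣ y ℚ.- z ∣
∣x-z∣≤ x y z = subst (λ t → ℚ.∣ t ∣ ℚ.≤ ℚ.∣ x ℚ.- y ∣ ℚ.+ ℚ.∣ y ℚ.- z ∣)
  (solve 3 (λ x y z → (x :- y) :+ (y :- z) := x :- z) ≡.refl x y z)
  (ℚ.∣p+q∣≤∣p∣+∣q∣ (x ℚ.- y) (y ℚ.- z))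
  where open ℚSolver.+-*-Solver

∣x-y∣≡∣y-x∣ : ∀ x y → ℚ.∣ x ℚ.- y ∣ ≡ ℚ.∣ y ℚ.- x ∣
∣x-y∣≡∣y-x∣ x y = ≡.trans (≡.sym (ℚ.∣-p∣≡∣p∣ (x ℚ.- y)))
  (cong ℚ.∣_∣ (solve 2 (λ x y → :- (x :- y) := y :- x) ≡.refl x y))
  where open ℚSolver.+-*-Solver

halves : ∀ ε {a b c} → c ℚ.≤ a ℚ.+ b → a ℚ.< ½ ℚ.* ε → b ℚ.< ½ ℚ.* ε → c ℚ.< ε
halves ε {a} {b} {c} c≤ a< b< = subst (c ℚ.<_) (½+½ ε) (ℚ.≤-<-trans c≤ (ℚ.+-mono-< a< b<))

≡⇒≈ᴿ : ∀ {x y} → (∀ n → seq x n ≡ seq y n) → x ≈ᴿ y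
≡⇒≈ᴿ {x} {y} h ε ε>0 = 0 , λ n _ → subst (λ t → ℚ.∣ t ∣ ℚ.< ε)
  (≡.sym (≡.trans (cong (ℚ._- seq y n) (h n)) (ℚ.+-inverseʳ (seq y n)))) ε>0

≈ᴿ-sym : ∀ {x y} → x ≈ᴿ y → y ≈ᴿ x
≈ᴿ-sym {x} {y} h ε ε>0 = eventually-map
  (λ n → subst (ℚ._< ε) (∣x-y∣≡∣y-x∣ (seq x n) (seq y n))) (h ε ε>0)

≈ᴿ-trans : ∀ {x y z} → x ≈ᴿ y → y ≈ᴿ z → x ≈ᴿ z
≈ᴿ-trans {x} {y} {z} g h ε ε>0 = eventually-zip
  (λ n → halves ε (∣x-z∣≤ (seq x n) (seq y n) (seq z n))) (g (½ ℚ.* ε) (½*-pos ε>0)) (h (½ ℚ.* ε) (½*-pos ε>0))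

+ᴿ-cong : ∀ {x x′ y y′} → x ≈ᴿ x′ → y ≈ᴿ y′ → x +ᴿ y ≈ᴿ x′ +ᴿ y′
+ᴿ-cong {x} {x′} {y} {y′} g h ε ε>0 = eventually-zip
  (λ n → halves ε (subst (λ t → ℚ.∣ t ∣ ℚ.≤ ℚ.∣ seq x n ℚ.- seq x′ n ∣ ℚ.+ ℚ.∣ seq y n ℚ.- seq y′ n ∣)
    (solve 4 (λ x x′ y y′ → (x :- x′) :+ (y :- y′) := (x :+ y) :- (x′ :+ y′)) ≡.refl (seq x n) (seq x′ n) (seq y n) (seq y′ n))
    (ℚ.∣p+q∣≤∣p∣+∣q∣ (seq x n ℚ.- seq x′ n) (seq y n ℚ.- seq y′ n))))
  (g (½ ℚ.* ε) (½*-pos ε>0)) (h (½ ℚ.* ε) (½*-pos ε>0))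
  where open ℚSolver.+-*-Solver

negᴿ-cong : ∀ {x y} → x ≈ᴿ y → negᴿ x ≈ᴿ negᴿ y
negᴿ-cong {x} {y} h ε ε>0 = eventually-map
  (λ n → subst (ℚ._< ε) (≡.trans (∣x-y∣≡∣y-x∣ (seq x n) (seq y n)) (cong ℚ.∣_∣
    (solve 2 (λ x y → y :- x := (:- x) :- (:- y)) ≡.refl (seq x n) (seq y n))))) (h ε ε>0)
  where open ℚSolver.+-*-Solver

infix 4 ∣_∣≤_

∣_∣≤_ : ℝ → ℚ → Set
∣ x ∣≤ c = absᴿ x ≤ᴿ fromℚ c

bound-resp : ∀ {x y c} → x ≈ᴿ y → ∣ x ∣≤ c → ∣ y ∣≤ c
bound-resp {x} {y} {c} x≈y h ε ε>0 = eventually-zip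
  (λ n a b → ℚ.≤-<-trans
    (subst (λ t → ℚ.∣ t ∣ ℚ.≤ ℚ.∣ seq y n ℚ.- seq x n ∣ ℚ.+ ℚ.∣ seq x n ∣)
      (solve 2 (λ x y → (y :- x) :+ x := y) ≡.refl (seq x n) (seq y n))
      (ℚ.∣p+q∣≤∣p∣+∣q∣ (seq y n ℚ.- seq x n) (seq x n)))
    (ℚ.<-≤-trans (ℚ.+-mono-< (subst (ℚ._< ½ ℚ.* ε) (∣x-y∣≡∣y-x∣ (seq x n) (seq y n)) a) b)
      (ℚ.≤-reflexive (solve 2 (λ ε c → con ½ :* ε :+ (c :+ con ½ :* ε) := c :+ ε) ≡.refl ε c))))
  (x≈y (½ ℚ.* ε) (½*-pos ε>0)) (h (½ ℚ.* ε) (½*-pos ε>0))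
  where open ℚSolver.+-*-Solver

bound-mono : ∀ {x c d} → c ℚ.≤ d → ∣ x ∣≤ c → ∣ x ∣≤ d
bound-mono c≤d h ε ε>0 = eventually-map (λ n a → ℚ.<-≤-trans a (ℚ.+-monoˡ-≤ ε c≤d)) (h ε ε>0)

bound-neg : ∀ {x c} → ∣ x ∣≤ c → ∣ negᴿ x ∣≤ c
bound-neg {x} {c} h ε ε>0 = eventually-map
  (λ n → subst (ℚ._< c ℚ.+ ε) (≡.sym (ℚ.∣-p∣≡∣p∣ (seq x n)))) (h ε ε>0)

bound-+ : ∀ {x y c d} → ∣ x ∣≤ c → ∣ y ∣≤ d → ∣ x +ᴿ y ∣≤ c ℚ.+ d
bound-+ {x} {y} {c} {d} g h ε ε>0 = eventually-zip
  (λ n a b → ℚ.≤-<-trans (ℚ.∣p+q∣≤∣p∣+∣q∣ (seq x n) (seq y n))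
    (ℚ.<-≤-trans (ℚ.+-mono-< a b)
      (ℚ.≤-reflexive (solve 3 (λ ε c d → (c :+ con ½ :* ε) :+ (d :+ con ½ :* ε) := (c :+ d) :+ ε) ≡.refl ε c d))))
  (g (½ ℚ.* ε) (½*-pos ε>0)) (h (½ ℚ.* ε) (½*-pos ε>0))
  where open ℚSolver.+-*-Solver

bound-* : ∀ {x y c d} → 0ℚ ℚ.≤ c → 0ℚ ℚ.≤ d → ∣ x ∣≤ c → ∣ y ∣≤ d → ∣ x *ᴿ y ∣≤ c ℚ.* d
bound-* {x} {y} {c} {d} c≥0 d≥0 g h ε ε>0
  -- Expanding (c + η)(d + η) and using η² ≤ η leaves an excess of at most (c + d + 1) η over c d.
  = let η , η>0 , η≤1 , Bη≤ε = scaleBelow {c ℚ.+ d ℚ.+ 1ℚ} {ε} (ℚ.+-mono-≤-< (ℚ.+-mono-≤ c≥0 d≥0) (ℚ.positive⁻¹ 1ℚ)) ε>0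
  in eventually-zip
  (λ n a b → begin-strict
    ℚ.∣ seq x n ℚ.* seq y n ∣         ≡⟨ ℚ.∣p*q∣≡∣p∣*∣q∣ (seq x n) (seq y n) ⟩
    ℚ.∣ seq x n ∣ ℚ.* ℚ.∣ seq y n ∣   ≤⟨ *-monoˡ-≤ ℚ.∣ seq y n ∣ (ℚ.0≤∣p∣ (seq y n)) (ℚ.<⇒≤ a) ⟩
    (c ℚ.+ η) ℚ.* ℚ.∣ seq y n ∣       <⟨ ℚ.*-monoʳ-<-pos (c ℚ.+ η) {{ℚ.positive (ℚ.+-mono-≤-< c≥0 η>0)}} b ⟩
    (c ℚ.+ η) ℚ.* (d ℚ.+ η)           ≡⟨ solve 3 (λ c d η → (c :+ η) :* (d :+ η) := c :* d :+ ((c :+ d) :* η :+ η :* η)) ≡.refl c d η ⟩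
    c ℚ.* d ℚ.+ ((c ℚ.+ d) ℚ.* η ℚ.+ η ℚ.* η) ≤⟨ ℚ.+-monoʳ-≤ (c ℚ.* d) (ℚ.+-monoʳ-≤ ((c ℚ.+ d) ℚ.* η) (*-monoˡ-≤ η (ℚ.<⇒≤ η>0) η≤1)) ⟩
    c ℚ.* d ℚ.+ ((c ℚ.+ d) ℚ.* η ℚ.+ 1ℚ ℚ.* η) ≡⟨ cong (c ℚ.* d ℚ.+_) (≡.sym (ℚ.*-distribʳ-+ η (c ℚ.+ d) 1ℚ)) ⟩
    c ℚ.* d ℚ.+ (c ℚ.+ d ℚ.+ 1ℚ) ℚ.* η ≤⟨ ℚ.+-monoʳ-≤ (c ℚ.* d) Bη≤ε ⟩
    c ℚ.* d ℚ.+ ε                     ∎)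
  (g η η>0) (h η η>0)
  where
  open ℚSolver.+-*-Solver
  open ℚ.≤-Reasoning

bound-exists : ∀ x → ∃[ c ] (0ℚ ℚ.≤ c × ∣ x ∣≤ c)
bound-exists x = let N , h = cauchy x 1ℚ (ℚ.positive⁻¹ 1ℚ) in
  1ℚ ℚ.+ ℚ.∣ seq x N ∣ , ℚ.+-mono-≤ (ℚ.<⇒≤ (ℚ.positive⁻¹ 1ℚ)) (ℚ.0≤∣p∣ (seq x N)) , λ ε ε>0 → N , λ n n≥ →
    ℚ.≤-<-trans
      (subst (λ t → ℚ.∣ t ∣ ℚ.≤ 1ℚ ℚ.+ ℚ.∣ seq x N ∣)
        (solve 2 (λ x y → (y :- x) :+ x := y) ≡.refl (seq x N) (seq x n))
        (ℚ.≤-trans (ℚ.∣p+q∣≤∣p∣+∣q∣ (seq x n ℚ.- seq x N) (seq x N)) (ℚ.+-monoˡ-≤ ℚ.∣ seq x N ∣ (ℚ.<⇒≤ (h n N n≥ ℕ.≤-refl)))))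
      (subst (ℚ._< 1ℚ ℚ.+ ℚ.∣ seq x N ∣ ℚ.+ ε) (ℚ.+-identityʳ _) (ℚ.+-monoʳ-< (1ℚ ℚ.+ ℚ.∣ seq x N ∣) ε>0))
  where open ℚSolver.+-*-Solver

bound-fromℚ : ∀ r → ∣ fromℚ r ∣≤ ℚ.∣ r ∣
bound-fromℚ r ε ε>0 = 0 , λ _ _ →
  subst (ℚ._< ℚ.∣ r ∣ ℚ.+ ε) (ℚ.+-identityʳ ℚ.∣ r ∣) (ℚ.+-monoʳ-< ℚ.∣ r ∣ ε>0)

bound-fromℚ⁻¹ : ∀ {r c} → ∣ fromℚ r ∣≤ c → ℚ.∣ r ∣ ℚ.≤ c
bound-fromℚ⁻¹ h = ≤-of-<+ε λ ε ε>0 → let N , g = h ε ε>0 in g N ℕ.≤-refl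

-- Density is given at rational points only, so the competitor `j` is chosen for a rational
-- approximation of `x` depending on `ε`. Half of `ε` pays for the approximation, the other half for
-- the minimality inequality.
minimizer-bound : ∀ (x : ℝ) (c : ℤ → ℚ) h m → (∀ y → ∃[ j ] ℚ.∣ y ℚ.- c j ∣ ℚ.≤ h) →
  (∀ j → absᴿ (x -ᴿ fromℚ (c m)) ≤ᴿ absᴿ (x -ᴿ fromℚ (c j))) → ∣ x -ᴿ fromℚ (c m) ∣≤ h
minimizer-bound x c h m dense minimal ε ε>0
  = let N , close = cauchy x (½ ℚ.* ε) (½*-pos ε>0)
        j , near = dense (seq x N)
  in eventually-zip
    (λ n a b → begin-strict
      ℚ.∣ seq x n ℚ.- c m ∣                   <⟨ b ⟩
      ℚ.∣ seq x n ℚ.- c j ∣ ℚ.+ ½ ℚ.* ε       ≤⟨ ℚ.+-monoˡ-≤ (½ ℚ.* ε) (∣x-z∣≤ (seq x n) (seq x N) (c j)) ⟩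
      ℚ.∣ seq x n ℚ.- seq x N ∣ ℚ.+ ℚ.∣ seq x N ℚ.- c j ∣ ℚ.+ ½ ℚ.* ε
        <⟨ ℚ.+-monoˡ-< (½ ℚ.* ε) (ℚ.+-mono-<-≤ a near) ⟩
      ½ ℚ.* ε ℚ.+ h ℚ.+ ½ ℚ.* ε   ≡⟨ solve 2 (λ ε h → con ½ :* ε :+ h :+ con ½ :* ε := h :+ ε) ≡.refl ε h ⟩
      h ℚ.+ ε                     ∎)
    (N , λ n n≥ → close n N n≥ ℕ.≤-refl) (minimal j (½ ℚ.* ε) (½*-pos ε>0))
  where
  open ℚSolver.+-*-Solver
  open ℚ.≤-Reasoning

rescale : ∀ {r s} y j f → r ℚ.* s ≡ 1ℚ → y ℚ.- (s ℚ.* j ℚ.+ f) ≡ (r ℚ.* (y ℚ.- f) ℚ.- j) ℚ.* s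
rescale {r} {s} y j f rs≡1 = begin
  y ℚ.- (s ℚ.* j ℚ.+ f)                  ≡⟨ solve 4 (λ y s j f → y :- (s :* j :+ f) := con 1ℚ :* (y :- f) :- j :* s) ≡.refl y s j f ⟩
  1ℚ ℚ.* (y ℚ.- f) ℚ.- j ℚ.* s           ≡⟨ cong (λ t → t ℚ.* (y ℚ.- f) ℚ.- j ℚ.* s) rs≡1 ⟨
  r ℚ.* s ℚ.* (y ℚ.- f) ℚ.- j ℚ.* s      ≡⟨ solve 4 (λ z s j r → r :* s :* z :- j :* s := (r :* z :- j) :* s) ≡.refl (y ℚ.- f) s j r ⟩
  (r ℚ.* (y ℚ.- f) ℚ.- j) ℚ.* s          ∎
  where
  open ℚSolver.+-*-Solver
  open ≡.≡-Reasoning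

-- (y - f) / s is within ½ of an integer.
progression-dense : ∀ s {r} f → 0ℚ ℚ.≤ fromℤ s → r ℚ.* fromℤ s ≡ 1ℚ →
  ∀ y → ∃[ j ] ℚ.∣ y ℚ.- (fromℤ (s ℤ.* j) ℚ.+ f) ∣ ℚ.≤ ½ ℚ.* fromℤ s
progression-dense s {r} f s≥0 rs≡1 y = j , (begin
    ℚ.∣ y ℚ.- (fromℤ (s ℤ.* j) ℚ.+ f) ∣         ≡⟨ cong (λ t → ℚ.∣ y ℚ.- (t ℚ.+ f) ∣) (fromℤ-* s j) ⟩
    ℚ.∣ y ℚ.- (fromℤ s ℚ.* fromℤ j ℚ.+ f) ∣     ≡⟨ cong ℚ.∣_∣ (rescale {r} {fromℤ s} y (fromℤ j) f rs≡1) ⟩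
    ℚ.∣ t ℚ.* fromℤ s ∣                         ≡⟨ ℚ.∣p*q∣≡∣p∣*∣q∣ t (fromℤ s) ⟩
    ℚ.∣ t ∣ ℚ.* ℚ.∣ fromℤ s ∣                   ≡⟨ cong (ℚ.∣ t ∣ ℚ.*_) (ℚ.0≤p⇒∣p∣≡p s≥0) ⟩
    ℚ.∣ t ∣ ℚ.* fromℤ s                         ≤⟨ *-monoˡ-≤ (fromℤ s) s≥0 near ⟩
    ½ ℚ.* fromℤ s                               ∎)
  where
  open ℚ.≤-Reasoning
  j = proj₁ (nearestInteger (r ℚ.* (y ℚ.- f)))
  t = r ℚ.* (y ℚ.- f) ℚ.- fromℤ j
  near : ℚ.∣ t ∣ ℚ.≤ ½
  near = proj₂ (nearestInteger (r ℚ.* (y ℚ.- f)))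

-- An additive map ℚ → ℝ fixing 1 is the inclusion: compare at n = d · (n / d).
module AdditiveMap (h : ℚ → ℝ) (h-+ : ∀ x y → h (x ℚ.+ y) ≈ᴿ h x +ᴿ h y)
                   (h-neg : ∀ x → h (ℚ.- x) ≈ᴿ negᴿ (h x))
                   (h-0 : h 0ℚ ≈ᴿ fromℚ 0ℚ) (h-1 : h 1ℚ ≈ᴿ fromℚ 1ℚ) where
  open ℚSolver.+-*-Solver

  -- The natural number as an iterated sum of ones, the form to which additivity of `h` applies by
  -- recursion.
  nℚ : ℕ → ℚ
  nℚ zero    = 0ℚ
  nℚ (suc n) = 1ℚ ℚ.+ nℚ n

  nℚ≡fromℤ : ∀ n → nℚ n ≡ fromℤ (+ n)
  nℚ≡fromℤ zero    = ≡.refl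
  nℚ≡fromℤ (suc n) = ≡.trans (cong (1ℚ ℚ.+_) (nℚ≡fromℤ n)) (≡.sym (fromℤ-+ (+ 1) (+ n)))

  h-scale : ∀ n x → h (nℚ n ℚ.* x) ≈ᴿ fromℚ (nℚ n) *ᴿ h x
  h-scale zero x = ≈ᴿ-trans {h (0ℚ ℚ.* x)} {fromℚ 0ℚ} {fromℚ 0ℚ *ᴿ h x}
    (subst (λ t → h t ≈ᴿ fromℚ 0ℚ) (≡.sym (ℚ.*-zeroˡ x)) h-0)
    (≡⇒≈ᴿ {fromℚ 0ℚ} {fromℚ 0ℚ *ᴿ h x} λ m → ≡.sym (ℚ.*-zeroˡ (seq (h x) m)))
  h-scale (suc n) x = ≈ᴿ-trans {h (nℚ (suc n) ℚ.* x)} {h x +ᴿ (fromℚ (nℚ n) *ᴿ h x)} {fromℚ (nℚ (suc n)) *ᴿ h x}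
    (subst (λ t → h t ≈ᴿ h x +ᴿ (fromℚ (nℚ n) *ᴿ h x)) (distrib (nℚ n) x)
      (≈ᴿ-trans {h (x ℚ.+ nℚ n ℚ.* x)} {h x +ᴿ h (nℚ n ℚ.* x)} {h x +ᴿ (fromℚ (nℚ n) *ᴿ h x)} (h-+ x (nℚ n ℚ.* x))
        (+ᴿ-cong {h x} {h x} {h (nℚ n ℚ.* x)} {fromℚ (nℚ n) *ᴿ h x} (≡⇒≈ᴿ {h x} {h x} λ _ → ≡.refl) (h-scale n x))))
    (≡⇒≈ᴿ {h x +ᴿ (fromℚ (nℚ n) *ᴿ h x)} {fromℚ (nℚ (suc n)) *ᴿ h x} λ m → distrib (nℚ n) (seq (h x) m))
    where
    distrib : ∀ n y → y ℚ.+ n ℚ.* y ≡ (1ℚ ℚ.+ n) ℚ.* y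
    distrib = solve 2 (λ n y → y :+ n :* y := (con 1ℚ :+ n) :* y) ≡.refl

  h-ℕ : ∀ n → h (fromℤ (+ n)) ≈ᴿ fromℚ (fromℤ (+ n))
  h-ℕ n = subst (λ t → h t ≈ᴿ fromℚ t) (nℚ≡fromℤ n) (go n)
    where
    go : ∀ n → h (nℚ n) ≈ᴿ fromℚ (nℚ n)
    go zero    = h-0
    go (suc n) = ≈ᴿ-trans {h (nℚ (suc n))} {h 1ℚ +ᴿ h (nℚ n)} {fromℚ (nℚ (suc n))} (h-+ 1ℚ (nℚ n))
                   (+ᴿ-cong {h 1ℚ} {fromℚ 1ℚ} {h (nℚ n)} {fromℚ (nℚ n)} h-1 (go n))

  h-ℤ : ∀ a → h (fromℤ a) ≈ᴿ fromℚ (fromℤ a)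
  h-ℤ (+ n)    = h-ℕ n
  h-ℤ -[1+ n ] = ≈ᴿ-trans {h (fromℤ -[1+ n ])} {negᴿ (h (fromℤ (+ suc n)))} {fromℚ (fromℤ -[1+ n ])} (h-neg (fromℤ (+ suc n)))
    (negᴿ-cong {h (fromℤ (+ suc n))} {fromℚ (fromℤ (+ suc n))} (h-ℕ (suc n)))

  unscale : ∀ d x y → 0ℚ ℚ.< d → fromℚ d *ᴿ x ≈ᴿ fromℚ (d ℚ.* y) → x ≈ᴿ fromℚ y
  unscale d x y d>0 dx≈dy ε ε>0 = eventually-map
    (λ n a → ℚ.*-cancelˡ-<-nonNeg d {{ℚ.pos⇒nonNeg d {{ℚ.positive d>0}}}} (subst (ℚ._< d ℚ.* ε) (begin
      ℚ.∣ d ℚ.* seq x n ℚ.- d ℚ.* y ∣     ≡⟨ cong ℚ.∣_∣ (solve 3 (λ d x y → d :* x :- d :* y := d :* (x :- y)) ≡.refl d (seq x n) y) ⟩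
      ℚ.∣ d ℚ.* (seq x n ℚ.- y) ∣         ≡⟨ ℚ.∣p*q∣≡∣p∣*∣q∣ d (seq x n ℚ.- y) ⟩
      ℚ.∣ d ∣ ℚ.* ℚ.∣ seq x n ℚ.- y ∣     ≡⟨ cong (ℚ._* ℚ.∣ seq x n ℚ.- y ∣) (ℚ.0≤p⇒∣p∣≡p (ℚ.<⇒≤ d>0)) ⟩
      d ℚ.* ℚ.∣ seq x n ℚ.- y ∣           ∎) a))
    (dx≈dy (d ℚ.* ε) (*-pos d>0 ε>0))
    where open ≡.≡-Reasoning

  h≈fromℚ : ∀ x → h x ≈ᴿ fromℚ x
  h≈fromℚ x = unscale d (h x) x d>0 (≈ᴿ-trans {fromℚ d *ᴿ h x} {h (d ℚ.* x)} {fromℚ (d ℚ.* x)}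
    (≈ᴿ-sym {h (d ℚ.* x)} {fromℚ d *ᴿ h x} (subst (λ t → h (t ℚ.* x) ≈ᴿ fromℚ t *ᴿ h x) (nℚ≡fromℤ (ℚ.↧ₙ x)) (h-scale (ℚ.↧ₙ x) x)))
    (subst (λ t → h t ≈ᴿ fromℚ t) (≡.sym dx≡n) (h-ℤ (ℚ.↥ x))))
    where
    d = fromℤ (+ ℚ.↧ₙ x)
    d>0 : 0ℚ ℚ.< d
    d>0 = ℚ.<-≤-trans (ℚ.positive⁻¹ 1ℚ) (fromℤ-mono-≤ {+ 1} {+ ℚ.↧ₙ x} (ℤ.+≤+ (ℕ.s≤s ℕ.z≤n)))
    dx≡n : d ℚ.* x ≡ fromℤ (ℚ.↥ x)
    dx≡n = ≡.trans (ℚ.*-comm d x) (*-↧≡↥ x)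

-- Quadratic fields

module QuadraticFieldProperties (K : QuadraticField) where
  open QuadraticField K
  open Algebra.Properties.Ring ring
  open RingMorphisms.IsRingHomomorphism ι-isRingHomomorphism public
    using () renaming (+-homo to ι-+; *-homo to ι-*; -‿homo to ι-neg; 0#-homo to ι-0; 1#-homo to ι-1)
  module ≈-Reasoning = Relation.Binary.Reasoning.Setoid setoid

  ι-cong : ∀ {x y} → x ≡ y → ι x ≈ ι y
  ι-cong e = reflexive (cong ι e)

  ι-morphism : ℚ.+-*-rawRing -Raw-AlmostCommutative⟶ fromCommutativeRing commutativeRing
  ι-morphism = record
    { ⟦_⟧ = ι ; +-homo = ι-+ ; *-homo = ι-* ; -‿homo = ι-neg ; 0-homo = ι-0 ; 1-homo = ι-1 }

  ι-≟ : ∀ x y → Maybe (ι x ≈ ι y)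
  ι-≟ x y with x ℚ.≟ y
  ... | yes e = just (ι-cong e)
  ... | no _  = nothing

  -- The coefficients are rational, so `con c` denotes `ι c`. For this reason `0#` and `1#` are
  -- exchanged for `ι 0ℚ` and `ι 1ℚ` around many solver calls.
  module KSolver = Algebra.Solver.Ring ℚ.+-*-rawRing (fromCommutativeRing commutativeRing) ι-morphism ι-≟
  open KSolver using (solve; _:=_; _:+_; _:*_; _:-_; :-_; con)

  ι-sub : ∀ x y → ι (x ℚ.- y) ≈ ι x - ι y
  ι-sub x y = trans (ι-+ x (ℚ.- y)) (+-congˡ (ι-neg y))

  x-y≈0⇒x≈y : ∀ {x y} → x - y ≈ 0# → x ≈ y
  x-y≈0⇒x≈y {x} {y} = x∙y⁻¹≈ε⇒x≈y x y

  x≈y⇒x-y≈0 : ∀ {x y} → x ≈ y → x - y ≈ 0#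
  x≈y⇒x-y≈0 {x} {y} e = trans (+-congʳ e) (-‿inverseʳ y)

  cancel : ∀ {x y} → ¬ (y ≈ 0#) → y * x ≈ 0# → x ≈ 0#
  cancel {x} {y} y≉0 yx≈0 with z , yz≈1 ← inverse y y≉0 = begin
    x             ≈⟨ *-identityˡ x ⟨
    1# * x        ≈⟨ *-congʳ yz≈1 ⟨
    y * z * x     ≈⟨ solve 3 (λ x y z → y :* z :* x := z :* (y :* x)) refl x y z ⟩
    z * (y * x)   ≈⟨ *-congˡ yx≈0 ⟩
    z * 0#        ≈⟨ zeroʳ z ⟩
    0#            ∎
    where open ≈-Reasoning

  -- Several identities hold only modulo relations such as α e₁ = a e₁ + b e₂ or αₙ₊₁ δₙ = 1. With
  -- `f`, `g`, `h` as explicit cofactors of the relations, what remains is a polynomial identity for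
  -- the solver. A third slot that is not wanted is filled with 0.
  vanishing-combination : ∀ {x u v w} f g h → x ≈ f * u + g * v + h * w →
    u ≈ 0# → v ≈ 0# → w ≈ 0# → x ≈ 0#
  vanishing-combination {x} {u} {v} {w} f g h e u≈0 v≈0 w≈0 = begin
    x                              ≈⟨ e ⟩
    f * u + g * v + h * w          ≈⟨ +-cong (+-cong (*-congˡ u≈0) (*-congˡ v≈0)) (*-congˡ w≈0) ⟩
    f * 0# + g * 0# + h * 0#       ≈⟨ +-cong (+-cong (zeroʳ f) (zeroʳ g)) (zeroʳ h) ⟩
    0# + 0# + 0#                   ≈⟨ trans (+-congʳ (+-identityˡ 0#)) (+-identityˡ 0#) ⟩
    0#                             ∎
    where open ≈-Reasoning

  e₁≉0 : ¬ (e₁ ≈ 0#)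
  e₁≉0 e₁≈0 = ℚ.1≢0 (proj₁ (independent 1ℚ 0ℚ (begin
    ι 1ℚ * e₁ + ι 0ℚ * e₂   ≈⟨ +-cong (*-congˡ e₁≈0) (*-congʳ ι-0) ⟩
    ι 1ℚ * 0# + 0# * e₂     ≈⟨ +-cong (zeroʳ (ι 1ℚ)) (zeroˡ e₂) ⟩
    0# + 0#                 ≈⟨ +-identityˡ 0# ⟩
    0#                      ∎)))
    where open ≈-Reasoning

  form : ℚ → ℚ → ℚ → ℚ → ℚ
  form t d x y = x ℚ.* x ℚ.- t ℚ.* x ℚ.* y ℚ.+ d ℚ.* y ℚ.* y

  ι-form : ∀ t d x y → ι (form t d x y) ≈ ι x * ι x - ι t * ι x * ι y + ι d * ι y * ι y
  ι-form t d x y = begin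
    ι (form t d x y)                                      ≈⟨ ι-+ _ _ ⟩
    ι (x ℚ.* x ℚ.- t ℚ.* x ℚ.* y) + ι (d ℚ.* y ℚ.* y)     ≈⟨ +-cong (ι-sub _ _) (ι-*₃ d y y) ⟩
    ι (x ℚ.* x) - ι (t ℚ.* x ℚ.* y) + ι d * ι y * ι y     ≈⟨ +-congʳ (+-cong (ι-* x x) (-‿cong (ι-*₃ t x y))) ⟩
    ι x * ι x - ι t * ι x * ι y + ι d * ι y * ι y         ∎
    where
    open ≈-Reasoning
    ι-*₃ : ∀ x y z → ι (x ℚ.* y ℚ.* z) ≈ ι x * ι y * ι z
    ι-*₃ x y z = trans (ι-* (x ℚ.* y) z) (*-congʳ (ι-* x y))

  -- Multiplication by α has trace t and determinant d in the basis (e₁ , e₂), and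
  -- form t d x y is the norm of α y - x, which does not vanish since α y - x is invertible.
  module _ (α : Carrier) where
    private
      a = proj₁ (spanning (α * e₁))
      b = proj₁ (proj₂ (spanning (α * e₁)))
      c = proj₁ (spanning (α * e₂))
      d = proj₁ (proj₂ (spanning (α * e₂)))

      αe₁ : α * e₁ - (ι a * e₁ + ι b * e₂) ≈ 0#
      αe₁ = x≈y⇒x-y≈0 (proj₂ (proj₂ (spanning (α * e₁))))
      αe₂ : α * e₂ - (ι c * e₁ + ι d * e₂) ≈ 0#
      αe₂ = x≈y⇒x-y≈0 (proj₂ (proj₂ (spanning (α * e₂))))

    trace determinant : ℚ
    trace = a ℚ.+ d
    determinant = a ℚ.* d ℚ.- b ℚ.* c

    private
      ι-trace : ι trace ≈ ι a + ι d
      ι-trace = ι-+ a d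
      ι-det : ι determinant ≈ ι a * ι d - ι b * ι c
      ι-det = trans (ι-sub _ _) (+-cong (ι-* a d) (-‿cong (ι-* b c)))

    -- Cayley-Hamilton: the cofactors α - d and b form the first row of the adjugate of α - (a b; c
    -- d). Applied to the two relations they give e₁ times the characteristic polynomial, and e₁ can
    -- be cancelled.
    characteristic : α * α - ι trace * α + ι determinant ≈ 0#
    characteristic = cancel e₁≉0 (vanishing-combination (α - ι d) (ι b) 0#
      (begin
        e₁ * (α * α - ι trace * α + ι determinant)
          ≈⟨ *-congˡ (+-cong (+-congˡ (-‿cong (*-congʳ ι-trace))) ι-det) ⟩
        e₁ * (α * α - (ι a + ι d) * α + (ι a * ι d - ι b * ι c))
          ≈⟨ solve 8 (λ α e₁ e₂ a b c d o →
               e₁ :* (α :* α :- (a :+ d) :* α :+ (a :* d :- b :* c)) :=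
               (α :- d) :* (α :* e₁ :- (a :* e₁ :+ b :* e₂)) :+ b :* (α :* e₂ :- (c :* e₁ :+ d :* e₂)) :+ con 0ℚ :* o)
             refl α e₁ e₂ (ι a) (ι b) (ι c) (ι d) 0# ⟩
        (α - ι d) * (α * e₁ - (ι a * e₁ + ι b * e₂)) + ι b * (α * e₂ - (ι c * e₁ + ι d * e₂)) + ι 0ℚ * 0#
          ≈⟨ +-congˡ (*-congʳ ι-0) ⟩
        (α - ι d) * (α * e₁ - (ι a * e₁ + ι b * e₂)) + ι b * (α * e₂ - (ι c * e₁ + ι d * e₂)) + 0# * 0# ∎)
      αe₁ αe₂ refl)
      where open ≈-Reasoning

    -- The norm is g times its conjugate (t - α) y - x, here written as g - (2α - t) y. Thus only g
    -- and y g occur on the right.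
    form-factors : ∀ x y → let g = α * ι y - ι x in
      ι (form trace determinant x y) ≈ g * g - (α + α - ι trace) * (ι y * g)
    form-factors x y = begin
      ι (form trace determinant x y)  ≈⟨ ι-form trace determinant x y ⟩
      ι x * ι x - ι trace * ι x * ι y + ι determinant * ι y * ι y
        ≈⟨ solve 5 (λ α x y t d → let g = α :* y :- x in
             x :* x :- t :* x :* y :+ d :* y :* y :=
             (g :* g :- (α :+ α :- t) :* (y :* g)) :+ (α :* α :- t :* α :+ d) :* (y :* y))
           refl α (ι x) (ι y) (ι trace) (ι determinant) ⟩
      (g * g - (α + α - ι trace) * (ι y * g)) + (α * α - ι trace * α + ι determinant) * (ι y * ι y)
        ≈⟨ +-congˡ (trans (*-congʳ characteristic) (zeroˡ _)) ⟩
      (g * g - (α + α - ι trace) * (ι y * g)) + 0#  ≈⟨ +-identityʳ _ ⟩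
      g * g - (α + α - ι trace) * (ι y * g)         ∎
      where
      open ≈-Reasoning
      g = α * ι y - ι x

    -- Multiplication by g has the matrix (A, b y; c y, D). The rows of its adjugate are the
    -- coordinates of two elements that g multiplies to the norm times e₁ and e₂. If the norm
    -- vanishes, so do these elements, since g can be cancelled; by independence A, D, b y and c y
    -- are all 0. Then g e₁ = A e₁ + b y e₂ = 0, so g = 0.
    form≢0 : ∀ x y → ¬ (α * ι y - ι x ≈ 0#) → form trace determinant x y ≢ 0ℚ
    form≢0 x y g≉0 f≡0 = contradiction (cancel e₁≉0 e₁g≈0) g≉0
      where
      open ≈-Reasoning
      g = α * ι y - ι x
      A = a ℚ.* y ℚ.- x
      D = d ℚ.* y ℚ.- x
      ι-A : ι A ≈ ι a * ι y - ι x
      ι-A = trans (ι-sub _ _) (+-congʳ (ι-* a y))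
      ι-D : ι D ≈ ι d * ι y - ι x
      ι-D = trans (ι-sub _ _) (+-congʳ (ι-* d y))
      ι-neg-* : ∀ s → ι (ℚ.- (s ℚ.* y)) ≈ - (ι s * ι y)
      ι-neg-* s = trans (ι-neg _) (-‿cong (ι-* s y))

      norm≈0 : ι x * ι x - (ι a + ι d) * ι x * ι y + (ι a * ι d - ι b * ι c) * ι y * ι y ≈ 0#
      norm≈0 = begin
        ι x * ι x - (ι a + ι d) * ι x * ι y + (ι a * ι d - ι b * ι c) * ι y * ι y
          ≈⟨ +-cong (+-congˡ (-‿cong (*-congʳ (*-congʳ ι-trace)))) (*-congʳ (*-congʳ ι-det)) ⟨
        ι x * ι x - ι trace * ι x * ι y + ι determinant * ι y * ι y ≈⟨ ι-form trace determinant x y ⟨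
        ι (form trace determinant x y) ≈⟨ ι-cong f≡0 ⟩
        ι 0ℚ ≈⟨ ι-0 ⟩
        0# ∎

      D≡0,by≡0 : D ≡ 0ℚ × ℚ.- (b ℚ.* y) ≡ 0ℚ
      D≡0,by≡0 = independent D (ℚ.- (b ℚ.* y)) (cancel g≉0
        (vanishing-combination e₁ (ι y * (ι d * ι y - ι x)) (- (ι b * ι y * ι y)) (begin
          g * (ι D * e₁ + ι (ℚ.- (b ℚ.* y)) * e₂)
            ≈⟨ *-congˡ (+-cong (*-congʳ ι-D) (*-congʳ (ι-neg-* b))) ⟩
          g * ((ι d * ι y - ι x) * e₁ + - (ι b * ι y) * e₂)
            ≈⟨ solve 9 (λ α e₁ e₂ a b c d x y →
                 (α :* y :- x) :* ((d :* y :- x) :* e₁ :+ (:- (b :* y)) :* e₂) :=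
                 e₁ :* (x :* x :- (a :+ d) :* x :* y :+ (a :* d :- b :* c) :* y :* y)
                 :+ (y :* (d :* y :- x)) :* (α :* e₁ :- (a :* e₁ :+ b :* e₂))
                 :+ (:- (b :* y :* y)) :* (α :* e₂ :- (c :* e₁ :+ d :* e₂)))
               refl α e₁ e₂ (ι a) (ι b) (ι c) (ι d) (ι x) (ι y) ⟩
          _ ∎) norm≈0 αe₁ αe₂))

      A≡0,cy≡0 : ℚ.- (c ℚ.* y) ≡ 0ℚ × A ≡ 0ℚ
      A≡0,cy≡0 = independent (ℚ.- (c ℚ.* y)) A (cancel g≉0
        (vanishing-combination e₂ (- (ι c * ι y * ι y)) (ι y * (ι a * ι y - ι x)) (begin
          g * (ι (ℚ.- (c ℚ.* y)) * e₁ + ι A * e₂)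
            ≈⟨ *-congˡ (+-cong (*-congʳ (ι-neg-* c)) (*-congʳ ι-A)) ⟩
          g * (- (ι c * ι y) * e₁ + (ι a * ι y - ι x) * e₂)
            ≈⟨ solve 9 (λ α e₁ e₂ a b c d x y →
                 (α :* y :- x) :* ((:- (c :* y)) :* e₁ :+ (a :* y :- x) :* e₂) :=
                 e₂ :* (x :* x :- (a :+ d) :* x :* y :+ (a :* d :- b :* c) :* y :* y)
                 :+ (:- (c :* y :* y)) :* (α :* e₁ :- (a :* e₁ :+ b :* e₂))
                 :+ (y :* (a :* y :- x)) :* (α :* e₂ :- (c :* e₁ :+ d :* e₂)))
               refl α e₁ e₂ (ι a) (ι b) (ι c) (ι d) (ι x) (ι y) ⟩
          _ ∎) norm≈0 αe₁ αe₂))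

      e₁g≈0 : e₁ * g ≈ 0#
      e₁g≈0 = vanishing-combination (ι y) e₁ (- e₂) (begin
        e₁ * g
          ≈⟨ solve 7 (λ α e₁ e₂ a b x y →
               e₁ :* (α :* y :- x) :=
               y :* (α :* e₁ :- (a :* e₁ :+ b :* e₂)) :+ e₁ :* (a :* y :- x) :+ (:- e₂) :* (:- (b :* y)))
             refl α e₁ e₂ (ι a) (ι b) (ι x) (ι y) ⟩
        _ ∎)
        αe₁
        (trans (sym ι-A) (trans (ι-cong (proj₂ A≡0,cy≡0)) ι-0))
        (trans (sym (ι-neg-* b)) (trans (ι-cong (proj₂ D≡0,by≡0)) ι-0))

-- Valuations, absolute values and partial quotients

record Dyadic (r : ℚ) : Set where
  constructor dyadic
  field
    exponent  : ℕ
    numerator : ℤ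
    equation  : r ℚ.* fromℤ (2^ exponent) ≡ fromℤ numerator

module _ where
  open ℚSolver.+-*-Solver
  open ≡.≡-Reasoning

  fromℤ-2^-+ : ∀ i j → fromℤ (2^ (i ℕ.+ j)) ≡ fromℤ (2^ i) ℚ.* fromℤ (2^ j)
  fromℤ-2^-+ i j = ≡.trans (cong fromℤ (2^-+ i j)) (fromℤ-* (2^ i) (2^ j))

  dyadic-fromℤ : ∀ a → Dyadic (fromℤ a)
  dyadic-fromℤ a = dyadic 0 a (ℚ.*-identityʳ (fromℤ a))

  dyadic-* : ∀ {r s} → Dyadic r → Dyadic s → Dyadic (r ℚ.* s)
  dyadic-* {r} {s} (dyadic i a ra) (dyadic j b sb) = dyadic (i ℕ.+ j) (a ℤ.* b) (begin
    r ℚ.* s ℚ.* fromℤ (2^ (i ℕ.+ j))                 ≡⟨ cong (r ℚ.* s ℚ.*_) (fromℤ-2^-+ i j) ⟩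
    r ℚ.* s ℚ.* (fromℤ (2^ i) ℚ.* fromℤ (2^ j))      ≡⟨ solve 4 (λ r s x y → r :* s :* (x :* y) := (r :* x) :* (s :* y)) ≡.refl r s (fromℤ (2^ i)) (fromℤ (2^ j)) ⟩
    (r ℚ.* fromℤ (2^ i)) ℚ.* (s ℚ.* fromℤ (2^ j))    ≡⟨ cong₂ ℚ._*_ ra sb ⟩
    fromℤ a ℚ.* fromℤ b                              ≡⟨ fromℤ-* a b ⟨
    fromℤ (a ℤ.* b)                                  ∎)

  dyadic-+ : ∀ {r s} → Dyadic r → Dyadic s → Dyadic (r ℚ.+ s)
  dyadic-+ {r} {s} (dyadic i a ra) (dyadic j b sb) = dyadic (i ℕ.+ j) (a ℤ.* 2^ j ℤ.+ b ℤ.* 2^ i) (begin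
    (r ℚ.+ s) ℚ.* fromℤ (2^ (i ℕ.+ j))               ≡⟨ cong ((r ℚ.+ s) ℚ.*_) (fromℤ-2^-+ i j) ⟩
    (r ℚ.+ s) ℚ.* (fromℤ (2^ i) ℚ.* fromℤ (2^ j))    ≡⟨ solve 4 (λ r s x y → (r :+ s) :* (x :* y) := (r :* x) :* y :+ (s :* y) :* x) ≡.refl r s (fromℤ (2^ i)) (fromℤ (2^ j)) ⟩
    (r ℚ.* fromℤ (2^ i)) ℚ.* fromℤ (2^ j) ℚ.+ (s ℚ.* fromℤ (2^ j)) ℚ.* fromℤ (2^ i)
      ≡⟨ cong₂ (λ x y → x ℚ.* fromℤ (2^ j) ℚ.+ y ℚ.* fromℤ (2^ i)) ra sb ⟩
    fromℤ a ℚ.* fromℤ (2^ j) ℚ.+ fromℤ b ℚ.* fromℤ (2^ i) ≡⟨ cong₂ ℚ._+_ (fromℤ-* a (2^ j)) (fromℤ-* b (2^ i)) ⟨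
    fromℤ (a ℤ.* 2^ j) ℚ.+ fromℤ (b ℤ.* 2^ i)        ≡⟨ fromℤ-+ (a ℤ.* 2^ j) (b ℤ.* 2^ i) ⟨
    fromℤ (a ℤ.* 2^ j ℤ.+ b ℤ.* 2^ i)                ∎)

  dyadic-neg : ∀ {r} → Dyadic r → Dyadic (ℚ.- r)
  dyadic-neg {r} h = subst Dyadic (solve 1 (λ r → (:- con 1ℚ) :* r := :- r) ≡.refl r) (dyadic-* (dyadic-fromℤ -[1+ 0 ]) h)

dyadic-⌊⌋₂ : ∀ x → Dyadic ⌊ x ⌋₂
dyadic-⌊⌋₂ x = let t , e , _ = ⌊⌋₂-numerator x in dyadic (ℚ₂.exponent x) t e

module TwoAdic (K : QuadraticField) (σ₂ : Embedding K ℚ₂-rawRing) where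
  open QuadraticField K
  open QuadraticFieldProperties K
  private module σ = RingMorphisms.IsRingMonomorphism (Embedding.isRingMonomorphism σ₂)

  -- The case a = 0, j = 0 says v₂(σ₂ x) ≥ v.
  record Congr (v j : ℕ) (x : Carrier) (a : ℤ) : Set where
    constructor congr
    field congruent : Congruent v j (⟦ σ₂ ⟧ x) a

  V≥ : ℕ → Carrier → Set
  V≥ v x = Congr v 0 x ℤ.0ℤ

  congr-resp : ∀ {v j a x y} → x ≈ y → Congr v j x a → Congr v j y a
  congr-resp {v} {j} {a} {x} {y} x≈y (congr h) =
    congr (congruent-resp {v} {j} {a} (⟦ σ₂ ⟧ x) (⟦ σ₂ ⟧ y) (σ.⟦⟧-cong x≈y) h)

  private
    pull : ∀ {v j a x y} → ⟦ σ₂ ⟧ x ≈₂ y → Congruent v j y a → Congr v j x a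
    pull {v} {j} {a} {x} {y} x≈y h = congr (congruent-resp {v} {j} {a} y (⟦ σ₂ ⟧ x) (≈₂-sym (⟦ σ₂ ⟧ x) y x≈y) h)

  congr-+ : ∀ {v j a b x y} → Congr v j x a → Congr v j y b → Congr v j (x + y) (a ℤ.+ b)
  congr-+ {v} {j} {a} {b} {x} {y} (congr h) (congr g) = pull {y = ⟦ σ₂ ⟧ x Q₂.+ ⟦ σ₂ ⟧ y} (σ.+-homo x y)
    (congruent-+ {v} {j} {a} {b} (⟦ σ₂ ⟧ x) (⟦ σ₂ ⟧ y) h g)

  congr-neg : ∀ {v j a x} → Congr v j x a → Congr v j (- x) (ℤ.- a)
  congr-neg {v} {j} {a} {x} (congr h) = pull {y = Q₂.- ⟦ σ₂ ⟧ x} (σ.-‿homo x)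
    (congruent-neg {v} {j} {a} (⟦ σ₂ ⟧ x) h)

  congr-1 : ∀ v → Congr v 0 1# (+ 1)
  congr-1 v = pull {y = Q₂.1#} σ.1#-homo (congruent-1 v)

  congr-0 : ∀ v → Congr v 0 0# (+ 0)
  congr-0 v = congr-resp (-‿inverseʳ 1#) (congr-+ (congr-1 v) (congr-neg (congr-1 v)))

  congr-halve : ∀ {v j a x} → Congr (suc v) j (x + x) a → Congr v (suc j) x a
  congr-halve {v} {j} {a} {x} (congr h) = congr (congruent-halve {v} {j} {a} (⟦ σ₂ ⟧ x)
    (congruent-resp {suc v} {j} {a} (⟦ σ₂ ⟧ (x + x)) (⟦ σ₂ ⟧ x Q₂.+ ⟦ σ₂ ⟧ x) (σ.+-homo x x) h))

  V-resp : ∀ {v x y} → x ≈ y → V≥ v x → V≥ v y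
  V-resp = congr-resp

  V-+ : ∀ {v x y} → V≥ v x → V≥ v y → V≥ v (x + y)
  V-+ = congr-+

  V-neg : ∀ {v x} → V≥ v x → V≥ v (- x)
  V-neg = congr-neg

  V-sub : ∀ {v x y} → V≥ v x → V≥ v y → V≥ v (x - y)
  V-sub h g = V-+ h (V-neg g)

  V-* : ∀ {v w x y} → V≥ v x → V≥ w y → V≥ (v ℕ.+ w) (x * y)
  V-* {v} {w} {x} {y} (congr h) (congr g) = pull {y = ⟦ σ₂ ⟧ x Q₂.* ⟦ σ₂ ⟧ y} (σ.*-homo x y)
    (val-* {v} {w} (⟦ σ₂ ⟧ x) (⟦ σ₂ ⟧ y) h g)

  V-weaken : ∀ {v w x} → w ℕ.≤ v → V≥ v x → V≥ w x
  V-weaken {v} {w} {x} w≤v (congr h) = congr (congruent-weaken {v} {w} {0} {ℤ.0ℤ} (⟦ σ₂ ⟧ x) w≤v h)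

  congr⇒V : ∀ {v j a x} → Congr v j x a → 2^ v ℤ.* 2^ j ∣ a → V≥ v x
  congr⇒V {v} {j} {a} {x} (congr h) d = congr (congruent⇒val {v} {j} {a} (⟦ σ₂ ⟧ x) h d)

  V⇒∣ : ∀ {v j a x} → Congr v j x a → V≥ v x → 2^ v ℤ.* 2^ j ∣ a
  V⇒∣ {v} {j} {a} {x} (congr h) (congr g) = val⇒∣ {v} {j} {a} (⟦ σ₂ ⟧ x) h g

  V≥1⇒≉1 : ∀ {x} → V≥ 1 x → ¬ (x ≈ 1#)
  V≥1⇒≉1 h x≈1 = contradiction (ℤ.∣⇒∣ᵤ (V⇒∣ (congr-1 1) (V-resp x≈1 h))) 2∤1
    where
    2∤1 : ¬ (2 ℕ.∣ 1)
    2∤1 = ℕ.>⇒∤ (ℕ.s≤s (ℕ.s≤s ℕ.z≤n))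

  congr-ιℕ : ∀ v n → Congr v 0 (ι (fromℤ (+ n))) (+ n)
  congr-ιℕ v zero    = congr-resp (sym ι-0) (congr-0 v)
  congr-ιℕ v (suc n) = congr-resp (begin
    1# + ι (fromℤ (+ n))           ≈⟨ +-congʳ ι-1 ⟨
    ι 1ℚ + ι (fromℤ (+ n))         ≈⟨ ι-+ 1ℚ (fromℤ (+ n)) ⟨
    ι (1ℚ ℚ.+ fromℤ (+ n))         ≈⟨ ι-cong (fromℤ-+ (+ 1) (+ n)) ⟨
    ι (fromℤ (+ suc n))            ∎) (congr-+ (congr-1 v) (congr-ιℕ v n))
    where open ≈-Reasoning

  congr-ιℤ : ∀ v a → Congr v 0 (ι (fromℤ a)) a
  congr-ιℤ v (+ n)    = congr-ιℕ v n
  congr-ιℤ v -[1+ n ] = congr-resp (sym (ι-neg (fromℤ (+ suc n)))) (congr-neg (congr-ιℕ v (suc n)))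

  -- Induction on the exponent: r + r has denominator 2^j when r has 2^(j + 1). Each halving costs
  -- one power of 2 in the modulus, so the induction runs over all `v` at once.
  congr-dyadic : ∀ v {r} j a → r ℚ.* fromℤ (2^ j) ≡ fromℤ a → Congr v j (ι r) a
  congr-dyadic v {r} zero a e = congr-resp (ι-cong (≡.trans (≡.sym e) (ℚ.*-identityʳ r))) (congr-ιℤ v a)
  congr-dyadic v {r} (suc j) a e = congr-halve (congr-resp (ι-+ r r) (congr-dyadic (suc v) {r ℚ.+ r} j a (≡.trans
    (ℚS.solve 2 (λ r x → (r ℚS.:+ r) ℚS.:* x ℚS.:= r ℚS.:* (ℚS.con 2ℚ ℚS.:* x)) ≡.refl r (fromℤ (2^ j)))
    (≡.trans (cong (r ℚ.*_) (≡.sym (fromℤ-2^-+ 1 j))) e))))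
    where module ℚS = ℚSolver.+-*-Solver

  V-ιℤ : ∀ a → V≥ 0 (ι (fromℤ a))
  V-ιℤ a = congr⇒V (congr-ιℤ 0 a) (divides a (≡.sym (ℤ.*-identityʳ a)))

  V≥0-1 : V≥ 0 1#
  V≥0-1 = V-resp ι-1 (V-ιℤ (+ 1))

  V-ι-even : ∀ a → V≥ 1 (ι (fromℤ (+ 2 ℤ.* a)))
  V-ι-even a = congr⇒V (congr-ιℤ 1 (+ 2 ℤ.* a)) (∣m⇒∣m*n a ℤ.∣-refl)

  -- ℤ[1/2] ∩ ℤ₂ = ℤ: integrality at 2 makes the numerator divisible by the only denominator there
  -- is, a power of 2.
  integral-dyadic : ∀ {r} → Dyadic r → V≥ 0 (ι r) → ∃[ a ] r ≡ fromℤ a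
  integral-dyadic {r} (dyadic j a e) h = c , cancelʳ (≡.trans e (≡.trans (cong fromℤ (≡.trans a≡ (cong (c ℤ.*_) (ℤ.*-identityˡ (2^ j))))) (fromℤ-* c (2^ j))))
    where
    2ʲ∣a = V⇒∣ (congr-dyadic 0 {r} j a e) h
    c = ℤ._∣_.quotient 2ʲ∣a
    a≡ = ℤ._∣_.equality 2ʲ∣a
    instance
      2ʲ-pos : ℚ.Positive (fromℤ (2^ j))
      2ʲ-pos = ℚ.normalize-pos (2 ℕ.^ j) 1 {{_}} {{ℕ.m^n≢0 2 j}}
    cancelʳ : r ℚ.* fromℤ (2^ j) ≡ fromℤ c ℚ.* fromℤ (2^ j) → r ≡ fromℤ c
    cancelʳ eq = ℚ.≤-antisym (ℚ.*-cancelʳ-≤-pos (fromℤ (2^ j)) (ℚ.≤-reflexive eq))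
                             (ℚ.*-cancelʳ-≤-pos (fromℤ (2^ j)) (ℚ.≤-reflexive (≡.sym eq)))

  -- `k` is the exponent occurring in the representation of `⟦ σ₂ ⟧ x`; it need not be the least
  -- possible.
  denominator : ∀ x → ∃[ k ] V≥ 0 (ι (fromℤ (2^ k)) * x)
  denominator x = k , pull {y = ⟦ σ₂ ⟧ y Q₂.* ⟦ σ₂ ⟧ x} (σ.*-homo y x)
    (val-*-exponent (⟦ σ₂ ⟧ y) (⟦ σ₂ ⟧ x) (Congr.congruent {k} {0} {y} (congr⇒V (congr-ιℤ k (2^ k)) (divides (+ 1) (ℤS.solve 1 (λ x → x ℤS.:= ℤS.con (+ 1) ℤS.:* (x ℤS.:* ℤS.con (+ 1))) ≡.refl (2^ k))))))
    where
    module ℤS = ℤSolver.+-*-Solver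
    k = ℚ₂.exponent (⟦ σ₂ ⟧ x)
    y = ι (fromℤ (2^ k))

  V-sub-⌊⌋₂ : ∀ x → V≥ 1 (x - ι ⌊ ⟦ σ₂ ⟧ x ⌋₂)
  V-sub-⌊⌋₂ x = let t , e , d = ⌊⌋₂-numerator (⟦ σ₂ ⟧ x) in
    congr⇒V (congr-+ (congr {a = residue (ℚ₂.numerator (⟦ σ₂ ⟧ x)) (suc k)} (congruent-residue (ℚ₂.numerator (⟦ σ₂ ⟧ x)) k)) (congr-neg (congr-dyadic 1 {⌊ ⟦ σ₂ ⟧ x ⌋₂} k t e)))
      (subst (_∣ residue (ℚ₂.numerator (⟦ σ₂ ⟧ x)) (suc k) ℤ.- t) (2^-+ 1 k) d)
    where k = ℚ₂.exponent (⟦ σ₂ ⟧ x)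

module Real (K : QuadraticField) (σ∞ : Embedding K ℝ-rawRing) where
  open QuadraticField K
  open QuadraticFieldProperties K
  private module σ = RingMorphisms.IsRingMonomorphism (Embedding.isRingMonomorphism σ∞)

  σ∞-ι : ∀ r → ⟦ σ∞ ⟧ (ι r) ≈ᴿ fromℚ r
  σ∞-ι = AdditiveMap.h≈fromℚ h
    (λ x y → ≈ᴿ-trans {h (x ℚ.+ y)} {⟦ σ∞ ⟧ (ι x + ι y)} {h x +ᴿ h y} (σ.⟦⟧-cong (ι-+ x y)) (σ.+-homo (ι x) (ι y)))
    (λ x → ≈ᴿ-trans {h (ℚ.- x)} {⟦ σ∞ ⟧ (- ι x)} {negᴿ (h x)} (σ.⟦⟧-cong (ι-neg x)) (σ.-‿homo (ι x)))
    (≈ᴿ-trans {h 0ℚ} {⟦ σ∞ ⟧ 0#} {fromℚ 0ℚ} (σ.⟦⟧-cong ι-0) σ.0#-homo)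
    (≈ᴿ-trans {h 1ℚ} {⟦ σ∞ ⟧ 1#} {fromℚ 1ℚ} (σ.⟦⟧-cong ι-1) σ.1#-homo)
    where
    h : ℚ → ℝ
    h r = ⟦ σ∞ ⟧ (ι r)

  σ∞-sub-ι : ∀ x r → ⟦ σ∞ ⟧ (x - ι r) ≈ᴿ ⟦ σ∞ ⟧ x -ᴿ fromℚ r
  σ∞-sub-ι x r = ≈ᴿ-trans {⟦ σ∞ ⟧ (x - ι r)} {⟦ σ∞ ⟧ x +ᴿ ⟦ σ∞ ⟧ (- ι r)} {⟦ σ∞ ⟧ x -ᴿ fromℚ r} (σ.+-homo x (- ι r))
    (+ᴿ-cong {⟦ σ∞ ⟧ x} {⟦ σ∞ ⟧ x} {⟦ σ∞ ⟧ (- ι r)} {negᴿ (fromℚ r)} (≡⇒≈ᴿ {⟦ σ∞ ⟧ x} {⟦ σ∞ ⟧ x} λ _ → ≡.refl)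
      (≈ᴿ-trans {⟦ σ∞ ⟧ (- ι r)} {negᴿ (⟦ σ∞ ⟧ (ι r))} {negᴿ (fromℚ r)} (σ.-‿homo (ι r))
        (negᴿ-cong {⟦ σ∞ ⟧ (ι r)} {fromℚ r} (σ∞-ι r))))

  -- A wrapper that keeps `x` and `c` visible to unification; the underlying bound unfolds to a
  -- statement about rational sequences.
  record R≤ (x : Carrier) (c : ℚ) : Set where
    constructor bounded
    field bound : ∣ ⟦ σ∞ ⟧ x ∣≤ c

  R-resp : ∀ {x y c} → x ≈ y → R≤ x c → R≤ y c
  R-resp {x} {y} {c} x≈y (bounded h) = bounded (bound-resp {⟦ σ∞ ⟧ x} {⟦ σ∞ ⟧ y} {c} (σ.⟦⟧-cong x≈y) h)

  private
    pull : ∀ {x y c} → ⟦ σ∞ ⟧ x ≈ᴿ y → ∣ y ∣≤ c → R≤ x c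
    pull {x} {y} {c} x≈y h = bounded (bound-resp {y} {⟦ σ∞ ⟧ x} {c} (≈ᴿ-sym {⟦ σ∞ ⟧ x} {y} x≈y) h)

  R-neg : ∀ {x c} → R≤ x c → R≤ (- x) c
  R-neg {x} {c} (bounded h) = pull {y = negᴿ (⟦ σ∞ ⟧ x)} (σ.-‿homo x) (bound-neg {⟦ σ∞ ⟧ x} {c} h)

  R-+ : ∀ {x y c d} → R≤ x c → R≤ y d → R≤ (x + y) (c ℚ.+ d)
  R-+ {x} {y} {c} {d} (bounded h) (bounded g) = pull {y = ⟦ σ∞ ⟧ x +ᴿ ⟦ σ∞ ⟧ y} (σ.+-homo x y)
    (bound-+ {⟦ σ∞ ⟧ x} {⟦ σ∞ ⟧ y} {c} {d} h g)

  R-* : ∀ {x y c d} → 0ℚ ℚ.≤ c → 0ℚ ℚ.≤ d → R≤ x c → R≤ y d → R≤ (x * y) (c ℚ.* d)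
  R-* {x} {y} {c} {d} c≥0 d≥0 (bounded h) (bounded g) = pull {y = ⟦ σ∞ ⟧ x *ᴿ ⟦ σ∞ ⟧ y} (σ.*-homo x y)
    (bound-* {⟦ σ∞ ⟧ x} {⟦ σ∞ ⟧ y} {c} {d} c≥0 d≥0 h g)

  R-exists : ∀ x → ∃[ c ] (0ℚ ℚ.≤ c × R≤ x c)
  R-exists x = let c , c≥0 , h = bound-exists (⟦ σ∞ ⟧ x) in c , c≥0 , bounded h

  R-ι : ∀ r → R≤ (ι r) ℚ.∣ r ∣
  R-ι r = pull {y = fromℚ r} (σ∞-ι r) (bound-fromℚ r)

  R-ι⁻¹ : ∀ {r c} → R≤ (ι r) c → ℚ.∣ r ∣ ℚ.≤ c
  R-ι⁻¹ {r} {c} (bounded h) = bound-fromℚ⁻¹ (bound-resp {⟦ σ∞ ⟧ (ι r)} {fromℚ r} {c} (σ∞-ι r) h)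

halfSpacing : Parity → ℚ
halfSpacing 0ℙ = 1ℚ
halfSpacing 1ℙ = ½

-- The valuation guaranteed for β - b. Since x - ⌊x⌋₂ lies in 2ℤ₂, it stays there after an even
-- integer is subtracted, but only in ℤ₂ after an arbitrary one.
evenness : Parity → ℕ
evenness 0ℙ = 1
evenness 1ℙ = 0

module PartialQuotient (K : QuadraticField) (σ∞ : Embedding K ℝ-rawRing) (σ₂ : Embedding K ℚ₂-rawRing) where
  open QuadraticField K
  open QuadraticFieldProperties K
  open KSolver using (solve; _:=_; _:+_; _:*_; _:-_; :-_; con)
  open TwoAdic K σ₂
  open Real K σ∞
  open Algorithm K σ∞ σ₂

  quotient-dyadic : ∀ ϵ {β b} → IsPartialQuotient ϵ β b → Dyadic b
  quotient-dyadic ϵ {β} (m , _ , e) = subst Dyadic (≡.sym e)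
    (dyadic-+ (dyadic-fromℤ (spacing ϵ ℤ.* m)) (dyadic-⌊⌋₂ (⟦ σ₂ ⟧ β)))

  quotient-V : ∀ ϵ {β b} → IsPartialQuotient ϵ β b → V≥ (evenness ϵ) (β - ι b)
  quotient-V ϵ {β} {b} (m , _ , e) = V-resp (begin
    β - ι ⌊ ⟦ σ₂ ⟧ β ⌋₂ - ι (fromℤ (spacing ϵ ℤ.* m))
      ≈⟨ solve 3 (λ β x y → β :- x :- y := β :- (y :+ x)) refl β (ι ⌊ ⟦ σ₂ ⟧ β ⌋₂) (ι (fromℤ (spacing ϵ ℤ.* m))) ⟩
    β - (ι (fromℤ (spacing ϵ ℤ.* m)) + ι ⌊ ⟦ σ₂ ⟧ β ⌋₂)
      ≈⟨ +-congˡ (-‿cong (trans (ι-cong e) (ι-+ (fromℤ (spacing ϵ ℤ.* m)) ⌊ ⟦ σ₂ ⟧ β ⌋₂))) ⟨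
    β - ι b ∎)
    (V-sub (V-weaken (evenness≤1 ϵ) (V-sub-⌊⌋₂ β)) (V-multiple ϵ))
    where
    open ≈-Reasoning
    evenness≤1 : ∀ ϵ → evenness ϵ ℕ.≤ 1
    evenness≤1 0ℙ = ℕ.≤-refl
    evenness≤1 1ℙ = ℕ.z≤n
    V-multiple : ∀ ϵ → V≥ (evenness ϵ) (ι (fromℤ (spacing ϵ ℤ.* m)))
    V-multiple 0ℙ = V-ι-even m
    V-multiple 1ℙ = V-ιℤ (+ 1 ℤ.* m)

  quotient-R : ∀ ϵ {β b} → IsPartialQuotient ϵ β b → R≤ (β - ι b) (halfSpacing ϵ)
  quotient-R ϵ {β} {b} (m , (minimal , _) , e) =
    bounded (bound-resp {⟦ σ∞ ⟧ β -ᴿ fromℚ b} {⟦ σ∞ ⟧ (β - ι b)} {halfSpacing ϵ}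
      (≈ᴿ-sym {⟦ σ∞ ⟧ (β - ι b)} {⟦ σ∞ ⟧ β -ᴿ fromℚ b} (σ∞-sub-ι β b))
      (subst (λ b → ∣ ⟦ σ∞ ⟧ β -ᴿ fromℚ b ∣≤ halfSpacing ϵ) (≡.sym e)
        (minimizer-bound (⟦ σ∞ ⟧ β) candidate (halfSpacing ϵ) m (dense ϵ) minimal)))
    where
    candidate : ℤ → ℚ
    candidate i = fromℤ (spacing ϵ ℤ.* i) ℚ.+ ⌊ ⟦ σ₂ ⟧ β ⌋₂
    dense : ∀ ϵ y → ∃[ j ] ℚ.∣ y ℚ.- (fromℤ (spacing ϵ ℤ.* j) ℚ.+ ⌊ ⟦ σ₂ ⟧ β ⌋₂) ∣ ℚ.≤ halfSpacing ϵ
    dense 0ℙ = progression-dense (+ 2) {½} ⌊ ⟦ σ₂ ⟧ β ⌋₂ (ℚ.nonNegative⁻¹ 2ℚ) ≡.refl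
    dense 1ℙ = progression-dense (+ 1) {1ℚ} ⌊ ⟦ σ₂ ⟧ β ⌋₂ (ℚ.nonNegative⁻¹ 1ℚ) ≡.refl

-- Recurrences for the convergents

parity-alternates : ∀ n → parity n ≡ 0ℙ ⊎ parity (suc n) ≡ 0ℙ
parity-alternates 0             = inj₁ ≡.refl
parity-alternates 1             = inj₂ ≡.refl
parity-alternates (suc (suc n)) = parity-alternates n

-- The real bound for δ₀ ⋯ δₙ, equal to ½ to the power ⌈n/2⌉; the factor of index 0 is
-- `halfSpacing 0ℙ`, that is 1.
size : ℕ → ℚ
size zero    = 1ℚ
size (suc n) = size n ℚ.* halfSpacing (parity (suc n))

halfSpacing-* : ∀ n → halfSpacing (parity n) ℚ.* halfSpacing (parity (suc n)) ≡ ½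
halfSpacing-* 0             = ≡.refl
halfSpacing-* 1             = ≡.refl
halfSpacing-* (suc (suc n)) = halfSpacing-* n

size-suc-suc : ∀ n → size (suc (suc n)) ≡ ½ ℚ.* size n
size-suc-suc n = ≡.trans (ℚ.*-assoc (size n) _ _)
  (≡.trans (cong (size n ℚ.*_) (halfSpacing-* (suc n))) (ℚ.*-comm (size n) ½))

halfSpacing-nonNeg : ∀ ϵ → 0ℚ ℚ.≤ halfSpacing ϵ
halfSpacing-nonNeg 0ℙ = ℚ.nonNegative⁻¹ 1ℚ
halfSpacing-nonNeg 1ℙ = ℚ.nonNegative⁻¹ ½

size-nonNeg : ∀ n → 0ℚ ℚ.≤ size n
size-nonNeg zero    = ℚ.nonNegative⁻¹ 1ℚ
size-nonNeg (suc n) = *-nonNeg (size-nonNeg n) (halfSpacing-nonNeg (parity (suc n)))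

-- Linear decay is all that convergence needs. The shift by 2 makes the induction in steps of two
-- work: the size halves while n + 4 is at most twice n + 2.
size-decay : ∀ n → size n ℚ.* fromℤ (+ (2 ℕ.+ n)) ℚ.≤ 2ℚ
size-decay 0 = ℚ.≤-refl
size-decay 1 = ℚ.<⇒≤ (ℚ.*<* (ℤ.+<+ (ℕ.s≤s (ℕ.s≤s (ℕ.s≤s (ℕ.s≤s ℕ.z≤n))))))
size-decay (suc (suc n)) = begin
  size (suc (suc n)) ℚ.* fromℤ (+ (4 ℕ.+ n))
    ≡⟨ cong (ℚ._* fromℤ (+ (4 ℕ.+ n))) (size-suc-suc n) ⟩
  ½ ℚ.* size n ℚ.* fromℤ (+ (4 ℕ.+ n))
    ≤⟨ *-monoʳ-≤ (½ ℚ.* size n) (*-nonNeg (ℚ.nonNegative⁻¹ ½) (size-nonNeg n)) (fromℤ-mono-≤ {+ (4 ℕ.+ n)} {+ (m ℕ.+ m)} (ℤ.+≤+ (ℕ.+-monoʳ-≤ 2 (ℕ.m≤n+m m n)))) ⟩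
  ½ ℚ.* size n ℚ.* fromℤ (+ (m ℕ.+ m))
    ≡⟨ cong (½ ℚ.* size n ℚ.*_) (fromℤ-+ (+ m) (+ m)) ⟩
  ½ ℚ.* size n ℚ.* (fromℤ (+ m) ℚ.+ fromℤ (+ m))
    ≡⟨ solve 2 (λ s x → con ½ :* s :* (x :+ x) := s :* x) ≡.refl (size n) (fromℤ (+ m)) ⟩
  size n ℚ.* fromℤ (+ m)
    ≤⟨ size-decay n ⟩
  2ℚ ∎
  where
  open ℚ.≤-Reasoning
  open ℚSolver.+-*-Solver
  m = 2 ℕ.+ n

size≤1 : ∀ n → size n ℚ.≤ 1ℚ
size≤1 n = ℚ.*-cancelʳ-≤-pos 2ℚ (ℚ.≤-trans (*-monoʳ-≤ (size n) (size-nonNeg n) (fromℤ-mono-≤ {+ 2} {+ (2 ℕ.+ n)} (ℤ.+≤+ (ℕ.m≤m+n 2 n)))) (size-decay n))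

size-vanishes : ∀ {η} → 0ℚ ℚ.< η → Eventually (λ n → size n ℚ.≤ η)
size-vanishes {η} η>0 = let N , 1≤Nη = archimedean η>0 in N ℕ.+ N , λ n n≥ → small N n 1≤Nη n≥
  where
  open ℚ.≤-Reasoning
  open ℚSolver.+-*-Solver
  small : ∀ N n → 1ℚ ℚ.≤ fromℤ (+ N) ℚ.* η → N ℕ.+ N ℕ.≤ n → size n ℚ.≤ η
  small N n 1≤Nη n≥ = ℚ.*-cancelʳ-≤-pos (fromℤ (+ (2 ℕ.+ n))) {{ℚ.normalize-pos (2 ℕ.+ n) 1}} (begin
    size n ℚ.* fromℤ (+ (2 ℕ.+ n))              ≤⟨ size-decay n ⟩
    1ℚ ℚ.+ 1ℚ                                   ≤⟨ ℚ.+-mono-≤ 1≤Nη 1≤Nη ⟩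
    fromℤ (+ N) ℚ.* η ℚ.+ fromℤ (+ N) ℚ.* η     ≡⟨ solve 2 (λ x y → x :* y :+ x :* y := y :* (x :+ x)) ≡.refl (fromℤ (+ N)) η ⟩
    η ℚ.* (fromℤ (+ N) ℚ.+ fromℤ (+ N))         ≡⟨ cong (η ℚ.*_) (fromℤ-+ (+ N) (+ N)) ⟨
    η ℚ.* fromℤ (+ (N ℕ.+ N))                   ≤⟨ *-monoʳ-≤ η (ℚ.<⇒≤ η>0) (fromℤ-mono-≤ {+ (N ℕ.+ N)} {+ (2 ℕ.+ n)} (ℤ.+≤+ (ℕ.≤-trans n≥ (ℕ.m≤n+m n 2)))) ⟩
    η ℚ.* fromℤ (+ (2 ℕ.+ n))                   ∎)

-- Only the data up to `last` are constrained, so that both kinds of run are covered: a halting run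
-- with its own last index, an infinite run truncated at any index.
module Run (K : QuadraticField) (σ∞ : Embedding K ℝ-rawRing) (σ₂ : Embedding K ℚ₂-rawRing)
  (αₙ : ℕ → QuadraticField.Carrier K) (bₙ : ℕ → ℚ) (last : ℕ)
  (quotient : ∀ n → n ℕ.≤ last → Algorithm.IsPartialQuotient K σ∞ σ₂ (parity n) (αₙ n) (bₙ n))
  (next : ∀ n → n ℕ.< last → Algorithm.IsNext K σ∞ σ₂ (αₙ n) (bₙ n) (αₙ (suc n))) where

  open QuadraticField K
  open QuadraticFieldProperties K
  open KSolver using (solve; _:=_; _:+_; _:*_; _:-_; :-_; con)
  open TwoAdic K σ₂
  open Real K σ∞
  open PartialQuotient K σ∞ σ₂

  α : Carrier
  α = αₙ 0

  δ : ℕ → Carrier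
  δ n = αₙ n - ι (bₙ n)

  gap : ℚ → ℚ → Carrier
  gap x y = α * ι y - ι x

  -- p′ n and q′ n are pₙ₋₁ and qₙ₋₁.
  p′ q′ : ℕ → ℚ
  p′ n = Mat₂.e₁₂ (convergentMatrix bₙ n)
  q′ n = Mat₂.e₂₂ (convergentMatrix bₙ n)

  e e′ : ℕ → Carrier
  e n = gap (p bₙ n) (q bₙ n)
  e′ n = gap (p′ n) (q′ n)

  private
    ι-step : ∀ x b y → ι (x ℚ.* b ℚ.+ y ℚ.* 1ℚ) ≈ ι x * ι b + ι y
    ι-step x b y = trans (ι-+ (x ℚ.* b) (y ℚ.* 1ℚ)) (+-cong (ι-* x b) (ι-cong (ℚ.*-identityʳ y)))

    shift : ∀ x y → x ℚ.* 1ℚ ℚ.+ y ℚ.* 0ℚ ≡ x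
    shift x y = ≡.trans (cong₂ ℚ._+_ (ℚ.*-identityʳ x) (ℚ.*-zeroʳ y)) (ℚ.+-identityʳ x)

  e-suc : ∀ n → e (suc n) ≈ e n * ι (bₙ (suc n)) + e′ n
  e-suc n = trans (+-cong (*-congˡ (ι-step (q bₙ n) (bₙ (suc n)) (q′ n))) (-‿cong (ι-step (p bₙ n) (bₙ (suc n)) (p′ n))))
    (solve 6 (λ α b x y x′ y′ → α :* (y :* b :+ y′) :- (x :* b :+ x′) := (α :* y :- x) :* b :+ (α :* y′ :- x′)) refl
      α (ι (bₙ (suc n))) (ι (p bₙ n)) (ι (q bₙ n)) (ι (p′ n)) (ι (q′ n)))

  e′-suc : ∀ n → e′ (suc n) ≈ e n
  e′-suc n = +-cong (*-congˡ (ι-cong (shift (q bₙ n) (q′ n)))) (-‿cong (ι-cong (shift (p bₙ n) (p′ n))))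

  e′-zero : e′ 0 ≈ - 1#
  e′-zero = trans (+-cong (trans (*-congˡ ι-0) (zeroʳ α)) (-‿cong ι-1)) (+-identityˡ (- 1#))

  -- Inductively eₙ₋₁ = - αₙ₊₁ eₙ because αₙ₊₁ δₙ = 1; inserted into eₙ₊₁ = bₙ₊₁ eₙ + eₙ₋₁ this
  -- gives eₙ₊₁ = - δₙ₊₁ eₙ. In the form of a vanishing sum it can serve as a relation for
  -- `vanishing-combination`.
  e+e′δ≈0 : ∀ n → n ℕ.≤ last → e n + e′ n * δ n ≈ 0#
  e+e′δ≈0 zero _ = begin
    (α * ι 1ℚ - ι (bₙ 0)) + e′ 0 * δ 0          ≈⟨ +-cong (+-congʳ (*-congˡ ι-1)) (*-congʳ e′-zero) ⟩
    (α * 1# - ι (bₙ 0)) + - 1# * (α - ι (bₙ 0)) ≈⟨ +-cong (+-congʳ (*-congˡ ι-1)) (*-congʳ (-‿cong ι-1)) ⟨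
    (α * ι 1ℚ - ι (bₙ 0)) + - ι 1ℚ * (α - ι (bₙ 0))
      ≈⟨ solve 2 (λ α b → (α :* con 1ℚ :- b) :+ (:- con 1ℚ) :* (α :- b) := con 0ℚ) refl α (ι (bₙ 0)) ⟩
    ι 0ℚ                                        ≈⟨ ι-0 ⟩
    0#                                          ∎
    where open ≈-Reasoning
  e+e′δ≈0 (suc n) n<last = vanishing-combination (αₙ (suc n)) (- e′ n) 0#
    (begin
      e (suc n) + e′ (suc n) * δ (suc n)
        ≈⟨ +-cong (e-suc n) (*-congʳ (e′-suc n)) ⟩
      (e n * ι (bₙ (suc n)) + e′ n) + e n * (αₙ (suc n) - ι (bₙ (suc n)))
        ≈⟨ solve 5 (λ e e′ b β d → (e :* b :+ e′) :+ e :* (β :- b) :=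
             β :* (e :+ e′ :* d) :+ (:- e′) :* (β :* d :- con 1ℚ) :+ con 0ℚ :* con 0ℚ) refl
             (e n) (e′ n) (ι (bₙ (suc n))) (αₙ (suc n)) (δ n) ⟩
      αₙ (suc n) * (e n + e′ n * δ n) + - e′ n * (αₙ (suc n) * δ n - ι 1ℚ) + ι 0ℚ * ι 0ℚ
        ≈⟨ +-congˡ (*-cong ι-0 ι-0) ⟩
      αₙ (suc n) * (e n + e′ n * δ n) + - e′ n * (αₙ (suc n) * δ n - ι 1ℚ) + 0# * 0# ∎)
    (e+e′δ≈0 n (ℕ.<⇒≤ n<last))
    (x≈y⇒x-y≈0 (trans (next n n<last) (sym ι-1)))
    refl
    where open ≈-Reasoning

  e≈-e′δ : ∀ n → n ℕ.≤ last → e n ≈ - (e′ n * δ n)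
  e≈-e′δ n n≤ = begin
    e n                                  ≈⟨ solve 2 (λ e x → e := (e :+ x) :- x) refl (e n) (e′ n * δ n) ⟩
    (e n + e′ n * δ n) - e′ n * δ n      ≈⟨ +-congʳ (e+e′δ≈0 n n≤) ⟩
    0# - e′ n * δ n                      ≈⟨ +-identityˡ _ ⟩
    - (e′ n * δ n)                       ∎
    where open ≈-Reasoning

  e-suc≈-eδ : ∀ n → n ℕ.< last → e (suc n) ≈ - (e n * δ (suc n))
  e-suc≈-eδ n n< = trans (e≈-e′δ (suc n) n<) (-‿cong (*-congʳ (e′-suc n)))

  V≥0-δ : ∀ n → n ℕ.≤ last → V≥ 0 (δ n)
  V≥0-δ n n≤ = V-weaken ℕ.z≤n (quotient-V (parity n) (quotient n n≤))

  V≥1-δδ : ∀ n → n ℕ.< last → V≥ 1 (δ n * δ (suc n))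
  V≥1-δδ n n< = [ first , second ]′ (parity-alternates n)
    where
    V-δ : ∀ n → n ℕ.≤ last → V≥ (evenness (parity n)) (δ n)
    V-δ n n≤ = quotient-V (parity n) (quotient n n≤)
    first : parity n ≡ 0ℙ → V≥ 1 (δ n * δ (suc n))
    first even = V-* (subst (λ ϵ → V≥ (evenness ϵ) (δ n)) even (V-δ n (ℕ.<⇒≤ n<))) (V≥0-δ (suc n) n<)
    second : parity (suc n) ≡ 0ℙ → V≥ 1 (δ n * δ (suc n))
    second even = V-* (V≥0-δ n (ℕ.<⇒≤ n<)) (subst (λ ϵ → V≥ (evenness ϵ) (δ (suc n))) even (V-δ (suc n) n<))

  V≥0-e : ∀ n → n ℕ.≤ last → V≥ 0 (e n)
  V≥0-e zero n≤ = V-resp (sym (e≈-e′δ 0 n≤)) (V-neg (V-* (V-resp (sym e′-zero) (V-neg V≥0-1)) (V≥0-δ 0 n≤)))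
  V≥0-e (suc n) n< = V-resp (sym (e-suc≈-eδ n n<)) (V-neg (V-* (V≥0-e n (ℕ.<⇒≤ n<)) (V≥0-δ (suc n) n<)))

  Odd : Carrier → Set
  Odd x = V≥ 1 (x - 1#)

  odd⇒V≥0 : ∀ {x} → Odd x → V≥ 0 x
  odd⇒V≥0 {x} h = V-resp (begin
    x - 1# + 1#       ≈⟨ +-cong (+-congˡ (-‿cong ι-1)) ι-1 ⟨
    x - ι 1ℚ + ι 1ℚ   ≈⟨ solve 1 (λ x → x :- con 1ℚ :+ con 1ℚ := x) refl x ⟩
    x                 ∎) (V-+ (V-weaken ℕ.z≤n h) V≥0-1)
    where open ≈-Reasoning

  odd⇒≉0 : ∀ {x} → Odd x → ¬ (x ≈ 0#)
  odd⇒≉0 {x} h x≈0 = V≥1⇒≉1 (V-neg h) (begin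
    - (x - 1#)      ≈⟨ -‿cong (trans (+-congʳ x≈0) (+-identityˡ (- 1#))) ⟩
    - - 1#          ≈⟨ -‿involutive 1# ⟩
    1#              ∎)
    where
    open ≈-Reasoning
    open import Algebra.Properties.Ring ring using (-‿involutive)

  -- The two halves need each other. If qₙ eₙ₋₁ is odd, then qₙ eₙ₊₁ = qₙ eₙ₋₁ δₙ δₙ₊₁ is even; with
  -- qₙ₋₁ eₙ even as well, `recurrence` makes qₙ₊₁ eₙ odd.
  odd-qe′ : ∀ n → n ℕ.≤ last → Odd (ι (q bₙ n) * e′ n) × V≥ 1 (ι (q′ n) * e n)
  odd-qe′ zero n≤ =
      V-resp (begin
        -- Here q₀ = 1 and e₋₁ = -1, so the difference from 1 is -2.
        ι (fromℤ (+ 2 ℤ.* -[1+ 0 ]))     ≈⟨ solve 0 (con (fromℤ (+ 2 ℤ.* -[1+ 0 ])) := con 1ℚ :* (:- con 1ℚ) :- con 1ℚ) refl ⟩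
        ι 1ℚ * - ι 1ℚ - ι 1ℚ             ≈⟨ +-cong (*-congˡ (-‿cong ι-1)) (-‿cong ι-1) ⟩
        ι 1ℚ * - 1# - 1#                 ≈⟨ +-congʳ (*-congˡ e′-zero) ⟨
        ι (q bₙ 0) * e′ 0 - 1#           ∎) (V-ι-even -[1+ 0 ])
    , V-resp (sym (trans (*-congʳ ι-0) (zeroˡ (e 0)))) (congr-0 1)
    where open ≈-Reasoning
  odd-qe′ (suc n) n< =
      V-resp (begin
        -- The sign of x is reversed in the recurrence; -x - 1 = -(x - 1) - 2 shows that -x is odd
        -- too.
        (x * (δ n * δ (suc n)) + q′e) - (x - 1#) - ι (fromℤ (+ 2 ℤ.* + 1))
          ≈⟨ +-congʳ (+-congˡ (-‿cong (+-congˡ (-‿cong ι-1)))) ⟨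
        (x * (δ n * δ (suc n)) + q′e) - (x - ι 1ℚ) - ι (fromℤ (+ 2 ℤ.* + 1))
          ≈⟨ solve 3 (λ x y z → (y :+ z) :- (x :- con 1ℚ) :- con (fromℤ (+ 2 ℤ.* + 1)) := (y :+ z :- x) :- con 1ℚ) refl
              x (x * (δ n * δ (suc n))) q′e ⟩
        (x * (δ n * δ (suc n)) + q′e - x) - ι 1ℚ
          ≈⟨ +-cong recurrence (-‿cong (sym ι-1)) ⟨
        ι (q bₙ (suc n)) * e′ (suc n) - 1# ∎)
        (V-sub (V-sub (V-+ V≥1-xδδ V≥1-q′e) odd-x) (V-ι-even (+ 1)))
    , V-resp (begin
        x * (δ n * δ (suc n))                       ≈⟨ solve 4 (λ y e d d₁ → y :* e :* (d :* d₁) := y :* (:- ((:- (e :* d)) :* d₁))) refl (ι (q bₙ n)) (e′ n) (δ n) (δ (suc n)) ⟩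
        ι (q bₙ n) * - (- (e′ n * δ n) * δ (suc n)) ≈⟨ *-congˡ (-‿cong (*-congʳ (e≈-e′δ n n≤))) ⟨
        ι (q bₙ n) * - (e n * δ (suc n))            ≈⟨ *-cong (ι-cong (shift (q bₙ n) (q′ n))) (e-suc≈-eδ n n<) ⟨
        ι (q′ (suc n)) * e (suc n)                  ∎) V≥1-xδδ
    where
    open ≈-Reasoning
    n≤ = ℕ.<⇒≤ n<
    x = ι (q bₙ n) * e′ n
    q′e = ι (q′ n) * e n
    odd-x = proj₁ (odd-qe′ n n≤)
    V≥1-q′e = proj₂ (odd-qe′ n n≤)
    V≥1-xδδ : V≥ 1 (x * (δ n * δ (suc n)))
    V≥1-xδδ = V-* (odd⇒V≥0 odd-x) (V≥1-δδ n n<)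
    -- As x δₙ δₙ₊₁ = qₙ eₙ₊₁, this says that qₙ eₙ₋₁ - qₙ₋₁ eₙ changes sign from one index to the
    -- next, as the determinant of the convergent matrix does.
    recurrence : ι (q bₙ (suc n)) * e′ (suc n) ≈ x * (δ n * δ (suc n)) + q′e - x
    recurrence = x-y≈0⇒x≈y (vanishing-combination
      (ι (q bₙ n) * αₙ (suc n) - ι (q bₙ n) * δ (suc n))
      (- (ι (q bₙ n) * e′ n))
      0#
      (begin
        ι (q bₙ (suc n)) * e′ (suc n) - (x * (δ n * δ (suc n)) + q′e - x)
          ≈⟨ +-congʳ (*-cong (ι-step (q bₙ n) (bₙ (suc n)) (q′ n)) (e′-suc n)) ⟩
        (ι (q bₙ n) * ι (bₙ (suc n)) + ι (q′ n)) * e n - (x * (δ n * δ (suc n)) + q′e - x)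
          ≈⟨ solve 7 (λ y y′ b e e′ β d → (y :* b :+ y′) :* e :- (y :* e′ :* (d :* (β :- b)) :+ y′ :* e :- y :* e′)
               := (y :* β :- y :* (β :- b)) :* (e :+ e′ :* d) :+ (:- (y :* e′)) :* (β :* d :- con 1ℚ) :+ con 0ℚ :* con 0ℚ)
             refl (ι (q bₙ n)) (ι (q′ n)) (ι (bₙ (suc n))) (e n) (e′ n) (αₙ (suc n)) (δ n) ⟩
        (ι (q bₙ n) * αₙ (suc n) - ι (q bₙ n) * δ (suc n)) * (e n + e′ n * δ n)
          + - (ι (q bₙ n) * e′ n) * (αₙ (suc n) * δ n - ι 1ℚ) + ι 0ℚ * ι 0ℚ
          ≈⟨ +-congˡ (*-cong ι-0 ι-0) ⟩
        _ ∎)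
      (e+e′δ≈0 n n≤) (x≈y⇒x-y≈0 (trans (next n n<) (sym ι-1))) refl)

  q≢0 : ∀ n → n ℕ.≤ last → q bₙ n ≢ 0ℚ
  q≢0 n n≤ qₙ≡0 = odd⇒≉0 (proj₁ (odd-qe′ n n≤)) (trans (*-congʳ (trans (ι-cong qₙ≡0) ι-0)) (zeroˡ (e′ n)))

  -- eₙ is the factor of an odd product only at index n + 1, hence the strict inequality; at the
  -- last index of a halting run eₙ does vanish.
  e≉0 : ∀ n → n ℕ.< last → ¬ (e n ≈ 0#)
  e≉0 n n< e≈0 = odd⇒≉0 (proj₁ (odd-qe′ (suc n) n<)) (trans (*-congˡ (trans (e′-suc n) e≈0)) (zeroʳ _))

  V≥0-qe : ∀ n → n ℕ.≤ last → V≥ 0 (ι (q bₙ n) * e n)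
  V≥0-qe n n≤ = V-resp (begin
    - (ι (q bₙ n) * e′ n * δ n)   ≈⟨ solve 3 (λ y e d → :- (y :* e :* d) := y :* (:- (e :* d))) refl (ι (q bₙ n)) (e′ n) (δ n) ⟩
    ι (q bₙ n) * - (e′ n * δ n)   ≈⟨ *-congˡ (e≈-e′δ n n≤) ⟨
    ι (q bₙ n) * e n              ∎)
    (V-neg (V-* (odd⇒V≥0 (proj₁ (odd-qe′ n n≤))) (V≥0-δ n n≤)))
    where open ≈-Reasoning

  dyadic-convergents : ∀ n → n ℕ.≤ last →
    (Dyadic (p bₙ n) × Dyadic (p′ n)) × (Dyadic (q bₙ n) × Dyadic (q′ n))
  dyadic-convergents zero n≤ = (quotient-dyadic (parity 0) (quotient 0 n≤) , dyadic-fromℤ (+ 1)) , (dyadic-fromℤ (+ 1) , dyadic-fromℤ (+ 0))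
  dyadic-convergents (suc n) n< = let (dp , dp′) , (dq , dq′) = dyadic-convergents n (ℕ.<⇒≤ n<) in
    (step dp dp′ , back dp dp′) , (step dq dq′ , back dq dq′)
    where
    step : ∀ {x y} → Dyadic x → Dyadic y → Dyadic (x ℚ.* bₙ (suc n) ℚ.+ y ℚ.* 1ℚ)
    step dx dy = dyadic-+ (dyadic-* dx (quotient-dyadic (parity (suc n)) (quotient (suc n) n<))) (dyadic-* dy (dyadic-fromℤ (+ 1)))
    back : ∀ {x y} → Dyadic x → Dyadic y → Dyadic (x ℚ.* 1ℚ ℚ.+ y ℚ.* 0ℚ)
    back dx dy = dyadic-+ (dyadic-* dx (dyadic-fromℤ (+ 1))) (dyadic-* dy (dyadic-fromℤ (+ 0)))

  R-δ : ∀ n → n ℕ.≤ last → R≤ (δ n) (halfSpacing (parity n))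
  R-δ n n≤ = quotient-R (parity n) (quotient n n≤)

  R-e : ∀ n → n ℕ.≤ last → R≤ (e n) (size n)
  R-e zero n≤ = R-resp (begin
    δ 0                ≈⟨ solve 1 (λ d → d := :- ((:- con 1ℚ) :* d)) refl (δ 0) ⟩
    - (- ι 1ℚ * δ 0)   ≈⟨ -‿cong (*-congʳ (trans e′-zero (-‿cong (sym ι-1)))) ⟨
    - (e′ 0 * δ 0)     ≈⟨ e≈-e′δ 0 n≤ ⟨
    e 0                ∎) (R-δ 0 n≤)
    where open ≈-Reasoning
  R-e (suc n) n< = R-resp (sym (e-suc≈-eδ n n<))
    (R-neg (R-* (size-nonNeg n) (halfSpacing-nonNeg (parity (suc n))) (R-e n (ℕ.<⇒≤ n<)) (R-δ (suc n) n<)))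

-- Convergence

fromℤ-pos : ∀ n .{{_ : ℕ.NonZero n}} → 0ℚ ℚ.< fromℤ (+ n)
fromℤ-pos n = ℚ.positive⁻¹ (fromℤ (+ n)) {{ℚ.normalize-pos n 1}}

module NormBound (K : QuadraticField) (σ∞ : Embedding K ℝ-rawRing) (σ₂ : Embedding K ℚ₂-rawRing)
  (α : QuadraticField.Carrier K) where

  open QuadraticField K
  open QuadraticFieldProperties K
  open KSolver using (solve; _:=_; _:+_; _:*_; _:-_; :-_; con)
  open TwoAdic K σ₂
  open Real K σ∞

  private
    t = trace α
    d = determinant α
    γ = α + α - ι t
    k = proj₁ (denominator γ)
    D = fromℤ (+ ℚ.↧ₙ t) ℚ.* fromℤ (+ ℚ.↧ₙ d)

  -- Two separate tasks: `D` clears the denominators of trace and determinant, which puts the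
  -- weighted norm into ℤ[1/2], and 2^k makes γ = 2α - t, the difference of α and its conjugate,
  -- 2-adically integral.
  weight : ℚ
  weight = D ℚ.* fromℤ (2^ k)

  weight-pos : 0ℚ ℚ.< weight
  weight-pos = *-pos (*-pos (fromℤ-pos (ℚ.↧ₙ t)) (fromℤ-pos (ℚ.↧ₙ d))) (fromℤ-pos (2 ℕ.^ k) {{ℕ.m^n≢0 2 k}})

  γ-bound : ℚ
  γ-bound = proj₁ (R-exists γ)

  γ-bound-nonNeg : 0ℚ ℚ.≤ γ-bound
  γ-bound-nonNeg = proj₁ (proj₂ (R-exists γ))

  private
    dyadic-norm : ∀ {x y} → Dyadic x → Dyadic y → Dyadic (weight ℚ.* form t d x y)
    dyadic-norm {x} {y} dx dy = subst Dyadic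
      (begin
        (Dt ℚ.* Dd ℚ.* (x ℚ.* x) ℚ.- T ℚ.* Dd ℚ.* (x ℚ.* y) ℚ.+ Δ ℚ.* Dt ℚ.* (y ℚ.* y)) ℚ.* P
          ≡⟨ cong₂ (λ T Δ → (Dt ℚ.* Dd ℚ.* (x ℚ.* x) ℚ.- T ℚ.* Dd ℚ.* (x ℚ.* y) ℚ.+ Δ ℚ.* Dt ℚ.* (y ℚ.* y)) ℚ.* P) (*-↧≡↥ t) (*-↧≡↥ d) ⟨
        (Dt ℚ.* Dd ℚ.* (x ℚ.* x) ℚ.- t ℚ.* Dt ℚ.* Dd ℚ.* (x ℚ.* y) ℚ.+ d ℚ.* Dd ℚ.* Dt ℚ.* (y ℚ.* y)) ℚ.* P
          ≡⟨ ℚS.solve 7 (λ u v P t d x y →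
              (u ℚS.:* v ℚS.:* (x ℚS.:* x) ℚS.:- t ℚS.:* u ℚS.:* v ℚS.:* (x ℚS.:* y) ℚS.:+ d ℚS.:* v ℚS.:* u ℚS.:* (y ℚS.:* y)) ℚS.:* P
              ℚS.:= u ℚS.:* v ℚS.:* P ℚS.:* (x ℚS.:* x ℚS.:- t ℚS.:* x ℚS.:* y ℚS.:+ d ℚS.:* y ℚS.:* y)) ≡.refl Dt Dd P t d x y ⟩
        weight ℚ.* form t d x y ∎)
      (dyadic-* (dyadic-+ (dyadic-+
        (dyadic-* (dyadic-* dDt dDd) (dyadic-* dx dx))
        (dyadic-neg (dyadic-* (dyadic-* (dyadic-fromℤ (ℚ.↥ t)) dDd) (dyadic-* dx dy))))
        (dyadic-* (dyadic-* (dyadic-fromℤ (ℚ.↥ d)) dDt) (dyadic-* dy dy))) (dyadic-fromℤ (2^ k)))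
      where
      open ≡.≡-Reasoning
      module ℚS = ℚSolver.+-*-Solver
      Dt = fromℤ (+ ℚ.↧ₙ t)
      Dd = fromℤ (+ ℚ.↧ₙ d)
      T = fromℤ (ℚ.↥ t)
      Δ = fromℤ (ℚ.↥ d)
      P = fromℤ (2^ k)
      dDt = dyadic-fromℤ (+ ℚ.↧ₙ t)
      dDd = dyadic-fromℤ (+ ℚ.↧ₙ d)

  -- The norm of α y - x, scaled by the weight, is a nonzero integer.
  norm-bound : ∀ {x y c} → Dyadic x → Dyadic y → let g = α * ι y - ι x in
    V≥ 0 g → V≥ 0 (ι y * g) → ¬ (g ≈ 0#) → 0ℚ ℚ.≤ c → R≤ g c →
    1ℚ ℚ.≤ weight ℚ.* (c ℚ.* c ℚ.+ γ-bound ℚ.* (ℚ.∣ y ∣ ℚ.* c))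
  norm-bound {x} {y} {c} dx dy V-g V-yg g≉0 c≥0 R-g = ℚ.≤-trans
    (subst (λ r → 1ℚ ℚ.≤ ℚ.∣ r ∣) (≡.sym N≡a) (1≤∣fromℤ∣ a≢0))
    (R-ι⁻¹ (R-resp (sym ι-N) (subst (R≤ (ι weight * (g * g - γ * (ι y * g)))) (cong (ℚ._* bound) (ℚ.0≤p⇒∣p∣≡p (ℚ.<⇒≤ weight-pos)))
      (R-* (ℚ.0≤∣p∣ weight) bound≥0 (R-ι weight)
        (R-+ (R-* c≥0 c≥0 R-g R-g) (R-neg (R-* γ-bound-nonNeg yc≥0 (proj₂ (proj₂ (R-exists γ))) (R-* (ℚ.0≤∣p∣ y) c≥0 (R-ι y) R-g))))))))
    where
    g = α * ι y - ι x
    N = weight ℚ.* form t d x y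
    bound = c ℚ.* c ℚ.+ γ-bound ℚ.* (ℚ.∣ y ∣ ℚ.* c)
    yc≥0 : 0ℚ ℚ.≤ ℚ.∣ y ∣ ℚ.* c
    yc≥0 = *-nonNeg (ℚ.0≤∣p∣ y) c≥0
    bound≥0 : 0ℚ ℚ.≤ bound
    bound≥0 = ℚ.+-mono-≤ (*-nonNeg c≥0 c≥0) (*-nonNeg γ-bound-nonNeg yc≥0)

    ι-N : ι N ≈ ι weight * (g * g - γ * (ι y * g))
    ι-N = trans (ι-* weight (form t d x y)) (*-congˡ (form-factors α x y))

    V-ιD : V≥ 0 (ι D)
    V-ιD = V-resp (sym (ι-* (fromℤ (+ ℚ.↧ₙ t)) (fromℤ (+ ℚ.↧ₙ d)))) (V-* (V-ιℤ (+ ℚ.↧ₙ t)) (V-ιℤ (+ ℚ.↧ₙ d)))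

    -- Integrality cannot be checked on `x` and `y`, which may have powers of 2 in their
    -- denominators. It is checked on the factored form, where 2^k is grouped with γ, and g and y g
    -- are integral by hypothesis.
    V-N : V≥ 0 (ι N)
    V-N = V-resp (begin
      ι D * ι (fromℤ (2^ k)) * (g * g) - ι D * ((ι (fromℤ (2^ k)) * γ) * (ι y * g))
        ≈⟨ solve 5 (λ D P g γ z → D :* P :* (g :* g) :- D :* ((P :* γ) :* z) := (D :* P) :* (g :* g :- γ :* z)) refl
             (ι D) (ι (fromℤ (2^ k))) g γ (ι y * g) ⟩
      ι D * ι (fromℤ (2^ k)) * (g * g - γ * (ι y * g))
        ≈⟨ *-congʳ (ι-* D (fromℤ (2^ k))) ⟨
      ι weight * (g * g - γ * (ι y * g)) ≈⟨ ι-N ⟨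
      ι N ∎)
      (V-sub (V-* (V-* V-ιD (V-ιℤ (2^ k))) (V-* V-g V-g)) (V-* V-ιD (V-* (proj₂ (denominator γ)) V-yg)))
      where open ≈-Reasoning

    integer : ∃[ a ] N ≡ fromℤ a
    integer = integral-dyadic (dyadic-norm dx dy) V-N
    a = proj₁ integer
    N≡a = proj₂ integer

    a≢0 : a ≢ ℤ.0ℤ
    a≢0 a≡0 = form≢0 α x y g≉0 (≡.trans (≡.sym (ℚ.*-identityˡ (form t d x y))) (≡.trans
      (cong (ℚ._* form t d x y) (≡.sym (ℚ.*-inverseˡ weight)))
      (≡.trans (ℚ.*-assoc (ℚ.1/ weight) weight (form t d x y))
        (≡.trans (cong (ℚ.1/ weight ℚ.*_) (≡.trans N≡a (cong fromℤ a≡0))) (ℚ.*-zeroʳ (ℚ.1/ weight))))))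
      where instance
        weight≢0 : ℚ.NonZero weight
        weight≢0 = ℚ.pos⇒nonZero weight {{ℚ.positive weight-pos}}

-- Here `y` stands for |qₙ|, `z` for its inverse and `c` for the bound on |eₙ|. Multiplied by `z`,
-- the norm inequality reads z ≤ W c (c z) + W M c; once W c ≤ ½ and c ≤ 1, the first term is at
-- most ½ z and can be moved to the left. So z ≤ 2 W M c, which means that |qₙ| is forced to be
-- large.
module _ {W M c y z : ℚ} (W≥0 : 0ℚ ℚ.≤ W) (M≥0 : 0ℚ ℚ.≤ M) (c≥0 : 0ℚ ℚ.≤ c) (c≤1 : c ℚ.≤ 1ℚ)
         (Wc≤½ : W ℚ.* c ℚ.≤ ½) (z≥0 : 0ℚ ℚ.≤ z) (yz≡1 : y ℚ.* z ≡ 1ℚ)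
         (h : 1ℚ ℚ.≤ W ℚ.* (c ℚ.* c ℚ.+ M ℚ.* (y ℚ.* c))) where
  open ℚ.≤-Reasoning
  open ℚSolver.+-*-Solver

  private
    z≤½z+WMc : z ℚ.≤ ½ ℚ.* z ℚ.+ W ℚ.* M ℚ.* c
    z≤½z+WMc = begin
      z                                                     ≡⟨ ℚ.*-identityˡ z ⟨
      1ℚ ℚ.* z                                              ≤⟨ *-monoˡ-≤ z z≥0 h ⟩
      W ℚ.* (c ℚ.* c ℚ.+ M ℚ.* (y ℚ.* c)) ℚ.* z             ≡⟨ solve 5 (λ W M c y z → W :* (c :* c :+ M :* (y :* c)) :* z := (W :* c) :* (c :* z) :+ W :* M :* c :* (y :* z)) ≡.refl W M c y z ⟩
      (W ℚ.* c) ℚ.* (c ℚ.* z) ℚ.+ W ℚ.* M ℚ.* c ℚ.* (y ℚ.* z) ≡⟨ cong (λ s → (W ℚ.* c) ℚ.* (c ℚ.* z) ℚ.+ s) (≡.trans (cong (W ℚ.* M ℚ.* c ℚ.*_) yz≡1) (ℚ.*-identityʳ (W ℚ.* M ℚ.* c))) ⟩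
      (W ℚ.* c) ℚ.* (c ℚ.* z) ℚ.+ W ℚ.* M ℚ.* c             ≤⟨ ℚ.+-monoˡ-≤ (W ℚ.* M ℚ.* c) (ℚ.≤-trans (*-monoˡ-≤ (c ℚ.* z) (*-nonNeg c≥0 z≥0) Wc≤½) (*-monoʳ-≤ ½ (ℚ.nonNegative⁻¹ ½) (*-monoˡ-≤ z z≥0 c≤1))) ⟩
      ½ ℚ.* (1ℚ ℚ.* z) ℚ.+ W ℚ.* M ℚ.* c                    ≡⟨ cong (λ s → ½ ℚ.* s ℚ.+ W ℚ.* M ℚ.* c) (ℚ.*-identityˡ z) ⟩
      ½ ℚ.* z ℚ.+ W ℚ.* M ℚ.* c                             ∎

    WMc≥0 : 0ℚ ℚ.≤ W ℚ.* M ℚ.* c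
    WMc≥0 = *-nonNeg (*-nonNeg W≥0 M≥0) c≥0

  -- The bound on `z` would make c z quadratic in `c`; the factor `c` is estimated by 1, since a
  -- linear bound already tends to 0.
  error-bound : c ℚ.* z ℚ.≤ 2ℚ ℚ.* (W ℚ.* M ℚ.* c)
  error-bound = begin
    c ℚ.* z                                             ≤⟨ *-monoˡ-≤ z z≥0 c≤1 ⟩
    1ℚ ℚ.* z                                            ≡⟨ solve 1 (λ z → con 1ℚ :* z := con 2ℚ :* (z :- con ½ :* z)) ≡.refl z ⟩
    2ℚ ℚ.* (z ℚ.- ½ ℚ.* z)                              ≤⟨ *-monoʳ-≤ 2ℚ (ℚ.nonNegative⁻¹ 2ℚ) (ℚ.+-monoˡ-≤ (ℚ.- (½ ℚ.* z)) z≤½z+WMc) ⟩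
    2ℚ ℚ.* (½ ℚ.* z ℚ.+ W ℚ.* M ℚ.* c ℚ.- ½ ℚ.* z)      ≡⟨ solve 2 (λ z w → con 2ℚ :* (con ½ :* z :+ w :- con ½ :* z) := con 2ℚ :* w) ≡.refl z (W ℚ.* M ℚ.* c) ⟩
    2ℚ ℚ.* (W ℚ.* M ℚ.* c)                              ∎

module Convergence (K : QuadraticField) (σ∞ : Embedding K ℝ-rawRing) (σ₂ : Embedding K ℚ₂-rawRing)
  (α : QuadraticField.Carrier K) where

  open QuadraticField K
  open QuadraticFieldProperties K
  open KSolver using (solve; _:=_; _:+_; _:*_; _:-_; :-_; con)
  open Real K σ∞

  -- `β` is the initial term α₀ of a run, which agrees with α only up to the equality of K.
  gap-quotient : ∀ {β} x y z → β ≈ α → y ℚ.* z ≡ 1ℚ → (β * ι y - ι x) * ι z ≈ α - ι (x ℚ.* z)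
  gap-quotient {β} x y z β≈α yz≡1 = begin
    (β * ι y - ι x) * ι z            ≈⟨ solve 4 (λ β x y z → (β :* y :- x) :* z := β :* (y :* z) :- x :* z) refl β (ι x) (ι y) (ι z) ⟩
    β * (ι y * ι z) - ι x * ι z      ≈⟨ +-cong (*-cong β≈α (trans (sym (ι-* y z)) (trans (ι-cong yz≡1) ι-1))) (-‿cong (sym (ι-* x z))) ⟩
    α * 1# - ι (x ℚ.* z)             ≈⟨ +-congʳ (*-identityʳ α) ⟩
    α - ι (x ℚ.* z)                  ∎
    where open ≈-Reasoning

  halting : (r : HaltingRun K σ∞ σ₂ α) → let open HaltingRun r in
    Σ[ q≢0 ∈ q bₙ last ≢ 0ℚ ] ⟦ σ∞ ⟧ α ≈ᴿ fromℚ (convergent bₙ last q≢0)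
  halting r = q≢0 , ≈ᴿ-trans {⟦ σ∞ ⟧ α} {⟦ σ∞ ⟧ (ι x)} {fromℚ x} (Embedding.isRingMonomorphism σ∞ .RingMorphisms.IsRingMonomorphism.⟦⟧-cong α≈x) (σ∞-ι x)
    where
    open HaltingRun r renaming (start to α₀≈α)
    open Run K σ∞ σ₂ αₙ bₙ last quotient next using (e; e′; δ; e≈-e′δ) renaming (q≢0 to run-q≢0)
    open ≈-Reasoning
    q≢0 = run-q≢0 last ℕ.≤-refl
    instance
      q-nonZero : ℚ.NonZero (q bₙ last)
      q-nonZero = ℚ.≢-nonZero q≢0
    x = convergent bₙ last q≢0
    -- Halting means that the last δ is 0, so α already equals the last convergent in K, before any
    -- embedding.
    e≈0 : e last ≈ 0#
    e≈0 = begin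
      e last                   ≈⟨ e≈-e′δ last ℕ.≤-refl ⟩
      - (e′ last * δ last)     ≈⟨ -‿cong (trans (*-congˡ (x≈y⇒x-y≈0 halt)) (zeroʳ (e′ last))) ⟩
      - 0#                     ≈⟨ trans (-‿cong (sym ι-0)) (trans (sym (ι-neg 0ℚ)) ι-0) ⟩
      0#                       ∎
    α≈x : α ≈ ι x
    α≈x = x-y≈0⇒x≈y (trans (sym (gap-quotient (p bₙ last) (q bₙ last) (ℚ.1/ q bₙ last) α₀≈α (ℚ.*-inverseʳ (q bₙ last))))
      (trans (*-congʳ e≈0) (zeroˡ _)))

  infinite : (r : InfiniteRun K σ∞ σ₂ α) → let open InfiniteRun r in
    Σ[ q≢0 ∈ (∀ n → q bₙ n ≢ 0ℚ) ] (λ n → fromℚ (convergent bₙ n (q≢0 n))) ⟶ ⟦ σ∞ ⟧ α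
  infinite r = q≢0 , limit
    where
    open InfiniteRun r
    module Upto (n : ℕ) = Run K σ∞ σ₂ αₙ bₙ n (λ m _ → quotient m) (λ m _ → next m)
    open NormBound K σ∞ σ₂ (αₙ 0)

    q≢0 : ∀ n → q bₙ n ≢ 0ℚ
    q≢0 n = Upto.q≢0 n n ℕ.≤-refl

    x : ℕ → ℚ
    x n = convergent bₙ n (q≢0 n)

    error : ∀ {ρ} n → weight ℚ.* size n ℚ.≤ ½ → 2ℚ ℚ.* (weight ℚ.* γ-bound ℚ.* size n) ℚ.≤ ρ →
      ∣ ⟦ σ∞ ⟧ α -ᴿ fromℚ (x n) ∣≤ ρ
    error {ρ} n Wc≤½ 2WMc≤ρ = bound-resp {⟦ σ∞ ⟧ (α - ι (x n))} {⟦ σ∞ ⟧ α -ᴿ fromℚ (x n)} {ρ} (σ∞-sub-ι α (x n))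
      (bound-mono {⟦ σ∞ ⟧ (α - ι (x n))} (ℚ.≤-trans cz≤ 2WMc≤ρ)
        (R≤.bound (R-resp (gap-quotient (p bₙ n) (q bₙ n) z start (ℚ.*-inverseʳ (q bₙ n)))
          (R-* (size-nonNeg n) (ℚ.0≤∣p∣ z) (R-e n n≤) (R-ι z)))))
      where
      -- One step beyond `n`, because eₙ ≠ 0 is read off index n + 1.
      open Upto (suc n) using (R-e; V≥0-e; V≥0-qe; e≉0; dyadic-convergents)
      n≤ = ℕ.n≤1+n n
      instance
        q-nonZero : ℚ.NonZero (q bₙ n)
        q-nonZero = ℚ.≢-nonZero (q≢0 n)
      z = ℚ.1/ q bₙ n
      dyadics = dyadic-convergents n n≤
      cz≤ : size n ℚ.* ℚ.∣ z ∣ ℚ.≤ 2ℚ ℚ.* (weight ℚ.* γ-bound ℚ.* size n)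
      cz≤ = error-bound {weight} {γ-bound} {size n} {ℚ.∣ q bₙ n ∣} {ℚ.∣ z ∣}
        (ℚ.<⇒≤ weight-pos) γ-bound-nonNeg (size-nonNeg n) (size≤1 n) Wc≤½ (ℚ.0≤∣p∣ z)
        (≡.trans (≡.sym (ℚ.∣p*q∣≡∣p∣*∣q∣ (q bₙ n) z)) (cong ℚ.∣_∣ (ℚ.*-inverseʳ (q bₙ n))))
        (norm-bound (proj₁ (proj₁ dyadics)) (proj₁ (proj₂ dyadics))
          (V≥0-e n n≤) (V≥0-qe n n≤) (e≉0 n ℕ.≤-refl) (size-nonNeg n) (R-e n n≤))

    errors : ∀ {ρ} → 0ℚ ℚ.< ρ → Eventually (λ n → ∣ ⟦ σ∞ ⟧ α -ᴿ fromℚ (x n) ∣≤ ρ)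
    errors {ρ} ρ>0 =
      let η , η>0 , _ , Wη≤½ = scaleBelow {weight} {½} weight-pos (ℚ.positive⁻¹ ½)
          θ , θ>0 , _ , Bθ≤ρ = scaleBelow {B} {ρ} B>0 ρ>0
      in eventually-zip
        (λ n c≤η c≤θ → error n
          (ℚ.≤-trans (*-monoʳ-≤ weight (ℚ.<⇒≤ weight-pos) c≤η) Wη≤½)
          (ℚ.≤-trans (scaled n) (ℚ.≤-trans (*-monoʳ-≤ B (ℚ.<⇒≤ B>0) c≤θ) Bθ≤ρ)))
        (size-vanishes η>0) (size-vanishes θ>0)
      where
      WM≥0 : 0ℚ ℚ.≤ weight ℚ.* γ-bound
      WM≥0 = *-nonNeg (ℚ.<⇒≤ weight-pos) γ-bound-nonNeg
      -- The summand 1 keeps `B` positive even when `γ-bound` is 0.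
      B = 1ℚ ℚ.+ 2ℚ ℚ.* (weight ℚ.* γ-bound)
      B>0 : 0ℚ ℚ.< B
      B>0 = ℚ.+-mono-<-≤ (ℚ.positive⁻¹ 1ℚ) (*-nonNeg (ℚ.nonNegative⁻¹ 2ℚ) WM≥0)
      scaled : ∀ n → 2ℚ ℚ.* (weight ℚ.* γ-bound ℚ.* size n) ℚ.≤ B ℚ.* size n
      scaled n = subst₂ ℚ._≤_ (ℚ.+-identityˡ _)
        (ℚS.solve 2 (λ w c → c ℚS.:+ ℚS.con 2ℚ ℚS.:* (w ℚS.:* c) ℚS.:= (ℚS.con 1ℚ ℚS.:+ ℚS.con 2ℚ ℚS.:* w) ℚS.:* c) ≡.refl (weight ℚ.* γ-bound) (size n))
        (ℚ.+-monoˡ-≤ (2ℚ ℚ.* (weight ℚ.* γ-bound ℚ.* size n)) (size-nonNeg n))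
        where module ℚS = ℚSolver.+-*-Solver

    limit : ∀ ε → fromℚ 0ℚ <ᴿ ε → ∃[ N ] (∀ n → N ℕ.≤ n → absᴿ (fromℚ (x n) -ᴿ ⟦ σ∞ ⟧ α) <ᴿ ε)
    limit ε (ε₀ , ε₀>0 , ε>ε₀) = eventually-map
      (λ n h → ½ ℚ.* ε₀ , ½*-pos ε₀>0 , eventually-zip
        (λ m a b → begin-strict
          ℚ.∣ x n ℚ.- seq (⟦ σ∞ ⟧ α) m ∣ ℚ.+ ½ ℚ.* ε₀   ≡⟨ cong (ℚ._+ ½ ℚ.* ε₀) (∣x-y∣≡∣y-x∣ (x n) (seq (⟦ σ∞ ⟧ α) m)) ⟩
          ℚ.∣ seq (⟦ σ∞ ⟧ α) m ℚ.- x n ∣ ℚ.+ ½ ℚ.* ε₀   <⟨ ℚ.+-monoˡ-< (½ ℚ.* ε₀) a ⟩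
          ρ ℚ.+ ρ ℚ.+ ½ ℚ.* ε₀                          ≡⟨ cong (ℚ._+ ½ ℚ.* ε₀) (½+½ (½ ℚ.* ε₀)) ⟩
          ½ ℚ.* ε₀ ℚ.+ ½ ℚ.* ε₀                         ≡⟨ ≡.trans (½+½ ε₀) (≡.sym (ℚ.+-identityˡ ε₀)) ⟩
          0ℚ ℚ.+ ε₀                                     <⟨ b ⟩
          seq ε m                                       ∎)
        (h ρ ρ>0) ε>ε₀)
      (errors ρ>0)
      where
      open ℚ.≤-Reasoning
      -- A quarter of ε₀: the bound ρ is attained only up to a further ρ, and the remaining half of
      -- ε₀ is the margin required by `_<ᴿ_`.
      ρ = ½ ℚ.* (½ ℚ.* ε₀)
      ρ>0 : 0ℚ ℚ.< ρ
      ρ>0 = ½*-pos (½*-pos ε₀>0)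

corollary3p14 : ExcludedMiddle 0ℓ →
    (K : QuadraticField)
    (σ∞ : Embedding K ℝ-rawRing) (σ₂ : Embedding K ℚ₂-rawRing)
    (α : QuadraticField.Carrier K) →
    ((r : InfiniteRun K σ∞ σ₂ α) → let open InfiniteRun r in
    Σ[ q≢0 ∈ (∀ n → q bₙ n ≢ 0ℚ) ]
    (λ n → fromℚ (convergent bₙ n (q≢0 n))) ⟶ ⟦ σ∞ ⟧ α)
    ×
    ((r : HaltingRun K σ∞ σ₂ α) → let open HaltingRun r in
    Σ[ q≢0 ∈ q bₙ last ≢ 0ℚ ]
    ⟦ σ∞ ⟧ α ≈ᴿ fromℚ (convergent bₙ last q≢0))
corollary3p14 _ K σ∞ σ₂ α = infinite , halting
  where open Convergence K σ∞ σ₂ α
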